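{- Let $n\ge 4$ and $3\le d\le n-2$, and let $\lambda_2^*=\max\{\lambda_2(T): T\in \mathcal{T}(n,d)\}$. Then $$\lambda_2^* < \sqrt{2+\sqrt{\left(\frac{n-d}{2}\right)^2+4}}.$$
   Context: All graphs are finite and simple. For a graph $G$, $\lambda_2(G)$ is the second largest eigenvalue (with multiplicity) of the adjacency matrix of $G$. $\mathcal{T}(n,d)$ is the set of trees on $n$ vertices with diameter $d$. -}

module Defs where

open import Level using (0ℓ)
open import Data.Bool using (Bool; true; false; if_then_else_)
open import Data.Fin using (Fin; zero; suc; toℕ; fromℕ; inject₁)
import Data.Fin as Fin
open import Data.Nat as ℕ using (ℕ; zero; suc; _⊔_)
import Data.Nat.Properties as ℕ
open import Data.Product using (Σ; ∃; ∃-syntax; _×_; _,_; proj₁; proj₂)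
open import Data.Rational as ℚ using (ℚ; 0ℚ; 1ℚ; ½)
import Data.Rational.Properties as ℚ
open import Data.Rational.Solver using (module +-*-Solver)
open import Data.Vec.Functional using (Vector; foldr)
open import Function using (_∘_)
open import Function.Definitions using (Injective)
open import Relation.Binary.PropositionalEquality
  using (_≡_; refl; sym; trans; cong; cong₂; subst)
open import Relation.Nullary using (¬_)

-- The real numbers as Cauchy sequences of rationals.  Equality of reals
-- is the setoid equality _≃_, never _≡_.

IsCauchy : (ℕ → ℚ) → Set
IsCauchy x = ∀ ε → 0ℚ ℚ.< ε →
  ∃[ N ] ∀ m n → N ℕ.≤ m → N ℕ.≤ n → ℚ.∣ x m ℚ.- x n ∣ ℚ.< ε

record ℝ : Set where
  constructor mkℝ
  field
    seq    : ℕ → ℚ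
    cauchy : IsCauchy seq

open ℝ public

infix  4 _≃_ _<_ _≤_
infixl 6 _+_
infixl 7 _*_

_≃_ : ℝ → ℝ → Set
x ≃ y = ∀ ε → 0ℚ ℚ.< ε →
  ∃[ N ] ∀ k → N ℕ.≤ k → ℚ.∣ seq x k ℚ.- seq y k ∣ ℚ.< ε

_<_ : ℝ → ℝ → Set
x < y = ∃[ ε ] 0ℚ ℚ.< ε ×
  (∃[ N ] ∀ k → N ℕ.≤ k → seq x k ℚ.+ ε ℚ.< seq y k)

_≤_ : ℝ → ℝ → Set
x ≤ y = ¬ (y < x)

fromℚ : ℚ → ℝ
fromℚ q = mkℝ (λ _ → q) λ ε 0<ε → 0 , λ _ _ _ _ →
  subst (ℚ._< ε) (cong ℚ.∣_∣ (sym (ℚ.+-inverseʳ q))) 0<ε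

0ℝ 1ℝ : ℝ
0ℝ = fromℚ 0ℚ
1ℝ = fromℚ 1ℚ

half-pos : ∀ ε → 0ℚ ℚ.< ε → 0ℚ ℚ.< ½ ℚ.* ε
half-pos ε 0<ε = subst (ℚ._< ½ ℚ.* ε) (ℚ.*-zeroʳ ½) (ℚ.*-monoʳ-<-pos ½ 0<ε)

halves : ∀ ε → ½ ℚ.* ε ℚ.+ ½ ℚ.* ε ≡ ε
halves ε = trans (sym (ℚ.*-distribʳ-+ ε ½ ½)) (ℚ.*-identityˡ ε)

+-cauchy : ∀ x y → IsCauchy x → IsCauchy y → IsCauchy (λ k → x k ℚ.+ y k)
+-cauchy x y cx cy ε 0<ε =
  let M , hx = cx (½ ℚ.* ε) (half-pos ε 0<ε)
      N , hy = cy (½ ℚ.* ε) (half-pos ε 0<ε)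
  in M ⊔ N , λ m n m≥ n≥ → begin-strict
  ℚ.∣ (x m ℚ.+ y m) ℚ.- (x n ℚ.+ y n) ∣
    ≡⟨ cong ℚ.∣_∣ (regroup (x m) (y m) (x n) (y n)) ⟩
  ℚ.∣ (x m ℚ.- x n) ℚ.+ (y m ℚ.- y n) ∣
    ≤⟨ ℚ.∣p+q∣≤∣p∣+∣q∣ (x m ℚ.- x n) (y m ℚ.- y n) ⟩
  ℚ.∣ x m ℚ.- x n ∣ ℚ.+ ℚ.∣ y m ℚ.- y n ∣
    <⟨ ℚ.+-mono-< (hx m n (ℕ.m⊔n≤o⇒m≤o M N m≥) (ℕ.m⊔n≤o⇒m≤o M N n≥))
                  (hy m n (ℕ.m⊔n≤o⇒n≤o M N m≥) (ℕ.m⊔n≤o⇒n≤o M N n≥)) ⟩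
  ½ ℚ.* ε ℚ.+ ½ ℚ.* ε
    ≡⟨ halves ε ⟩
  ε ∎
  where
  open ℚ.≤-Reasoning
  regroup : ∀ a b c d →
    (a ℚ.+ b) ℚ.- (c ℚ.+ d) ≡ (a ℚ.- c) ℚ.+ (b ℚ.- d)
  regroup = solve 4 (λ a b c d →
    (a :+ b) :- (c :+ d) := (a :- c) :+ (b :- d)) refl
    where open +-*-Solver

bounded : ∀ x → IsCauchy x →
  ∃[ B ] 0ℚ ℚ.< B × (∃[ N ] ∀ k → N ℕ.≤ k → ℚ.∣ x k ∣ ℚ.< B)
bounded x cx =
  let N , h = cx 1ℚ (ℚ.positive⁻¹ 1ℚ)
  in 1ℚ ℚ.+ ℚ.∣ x N ∣
  , ℚ.+-mono-<-≤ (ℚ.positive⁻¹ 1ℚ) (ℚ.0≤∣p∣ (x N))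
  , N , λ k k≥ → begin-strict
    ℚ.∣ x k ∣
      ≡⟨ cong ℚ.∣_∣ (split (x k) (x N)) ⟩
    ℚ.∣ (x k ℚ.- x N) ℚ.+ x N ∣
      ≤⟨ ℚ.∣p+q∣≤∣p∣+∣q∣ (x k ℚ.- x N) (x N) ⟩
    ℚ.∣ x k ℚ.- x N ∣ ℚ.+ ℚ.∣ x N ∣
      <⟨ ℚ.+-monoˡ-< ℚ.∣ x N ∣ (h k N k≥ ℕ.≤-refl) ⟩
    1ℚ ℚ.+ ℚ.∣ x N ∣ ∎
  where
  open ℚ.≤-Reasoning
  split : ∀ a b → a ≡ (a ℚ.- b) ℚ.+ b
  split = solve 2 (λ a b → a := (a :- b) :+ b) refl
    where open +-*-Solver

∣∣*∣∣-bound : ∀ p q B δ → 0ℚ ℚ.< B → ℚ.∣ p ∣ ℚ.< B → ℚ.∣ q ∣ ℚ.< δ →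
  ℚ.∣ p ℚ.* q ∣ ℚ.< B ℚ.* δ
∣∣*∣∣-bound p q B δ 0<B p<B q<δ = begin-strict
  ℚ.∣ p ℚ.* q ∣         ≡⟨ ℚ.∣p*q∣≡∣p∣*∣q∣ p q ⟩
  ℚ.∣ p ∣ ℚ.* ℚ.∣ q ∣   ≤⟨ ℚ.*-monoʳ-≤-nonNeg ℚ.∣ q ∣
                             {{ℚ.nonNegative (ℚ.0≤∣p∣ q)}} (ℚ.<⇒≤ p<B) ⟩
  B ℚ.* ℚ.∣ q ∣         <⟨ ℚ.*-monoʳ-<-pos B {{ℚ.positive 0<B}} q<δ ⟩
  B ℚ.* δ               ∎
  where open ℚ.≤-Reasoning

*-cauchy : ∀ x y → IsCauchy x → IsCauchy y → IsCauchy (λ k → x k ℚ.* y k)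
*-cauchy x y cx cy ε 0<ε =
  let A , 0<A , M₁ , hA = bounded x cx
      B , 0<B , N₁ , hB = bounded y cy
      δ , 0<δ , total   = share A B 0<A 0<B
      M₂ , hx = cx δ 0<δ
      N₂ , hy = cy δ 0<δ
  in (M₁ ⊔ N₁) ⊔ (M₂ ⊔ N₂) , λ m n m≥ n≥ →
    let m≥₁ = ℕ.m⊔n≤o⇒m≤o (M₁ ⊔ N₁) (M₂ ⊔ N₂) m≥
        m≥₂ = ℕ.m⊔n≤o⇒n≤o (M₁ ⊔ N₁) (M₂ ⊔ N₂) m≥
        n≥₁ = ℕ.m⊔n≤o⇒m≤o (M₁ ⊔ N₁) (M₂ ⊔ N₂) n≥
        n≥₂ = ℕ.m⊔n≤o⇒n≤o (M₁ ⊔ N₁) (M₂ ⊔ N₂) n≥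
    in begin-strict
    ℚ.∣ x m ℚ.* y m ℚ.- x n ℚ.* y n ∣
      ≡⟨ cong ℚ.∣_∣ (telescope (x m) (y m) (x n) (y n)) ⟩
    ℚ.∣ x m ℚ.* (y m ℚ.- y n) ℚ.+ y n ℚ.* (x m ℚ.- x n) ∣
      ≤⟨ ℚ.∣p+q∣≤∣p∣+∣q∣ (x m ℚ.* (y m ℚ.- y n)) (y n ℚ.* (x m ℚ.- x n)) ⟩
    ℚ.∣ x m ℚ.* (y m ℚ.- y n) ∣ ℚ.+ ℚ.∣ y n ℚ.* (x m ℚ.- x n) ∣
      <⟨ ℚ.+-mono-<
           (∣∣*∣∣-bound (x m) (y m ℚ.- y n) A δ 0<A
             (hA m (ℕ.m⊔n≤o⇒m≤o M₁ N₁ m≥₁))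
             (hy m n (ℕ.m⊔n≤o⇒n≤o M₂ N₂ m≥₂) (ℕ.m⊔n≤o⇒n≤o M₂ N₂ n≥₂)))
           (∣∣*∣∣-bound (y n) (x m ℚ.- x n) B δ 0<B
             (hB n (ℕ.m⊔n≤o⇒n≤o M₁ N₁ n≥₁))
             (hx m n (ℕ.m⊔n≤o⇒m≤o M₂ N₂ m≥₂) (ℕ.m⊔n≤o⇒m≤o M₂ N₂ n≥₂))) ⟩
    A ℚ.* δ ℚ.+ B ℚ.* δ
      ≡⟨ total ⟩
    ε ∎
  where
  open ℚ.≤-Reasoning
  telescope : ∀ a b c d → (a ℚ.* b) ℚ.- (c ℚ.* d)
    ≡ (a ℚ.* (b ℚ.- d)) ℚ.+ (d ℚ.* (a ℚ.- c))
  telescope = solve 4 (λ a b c d →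
    (a :* b) :- (c :* d) := (a :* (b :- d)) :+ (d :* (a :- c))) refl
    where open +-*-Solver
  share : ∀ A B → 0ℚ ℚ.< A → 0ℚ ℚ.< B →
    ∃[ δ ] 0ℚ ℚ.< δ × A ℚ.* δ ℚ.+ B ℚ.* δ ≡ ε
  share A B 0<A 0<B = r ℚ.* ε
    , subst (ℚ._< r ℚ.* ε) (ℚ.*-zeroʳ r)
        (ℚ.*-monoʳ-<-pos r {{ℚ.1/pos⇒pos (A ℚ.+ B)}} 0<ε)
    , trans (sym (ℚ.*-distribʳ-+ (r ℚ.* ε) A B))
      (trans (sym (ℚ.*-assoc (A ℚ.+ B) r ε))
      (trans (cong (ℚ._* ε) (ℚ.*-inverseʳ (A ℚ.+ B))) (ℚ.*-identityˡ ε)))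
    where
    instance
      A+B-pos : ℚ.Positive (A ℚ.+ B)
      A+B-pos = ℚ.positive (ℚ.+-mono-< 0<A 0<B)
      A+B-nz : ℚ.NonZero (A ℚ.+ B)
      A+B-nz = ℚ.pos⇒nonZero (A ℚ.+ B)
    r : ℚ
    r = ℚ.1/ (A ℚ.+ B)

_+_ : ℝ → ℝ → ℝ
seq    (x + y) k = seq x k ℚ.+ seq y k
cauchy (x + y)   = +-cauchy (seq x) (seq y) (cauchy x) (cauchy y)

_*_ : ℝ → ℝ → ℝ
seq    (x * y) k = seq x k ℚ.* seq y k
cauchy (x * y)   = *-cauchy (seq x) (seq y) (cauchy x) (cauchy y)

_IsSqrtOf_ : ℝ → ℝ → Set
s IsSqrtOf x = 0ℝ ≤ s × s * s ≃ x

sum : ∀ {n} → Vector ℝ n → ℝ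
sum = foldr _+_ 0ℝ

Matrix : ℕ → Set
Matrix n = Fin n → Fin n → ℝ

_·_ : ∀ {n} → Matrix n → Vector ℝ n → Vector ℝ n
(A · v) i = sum (λ j → A i j * v j)

LinearlyIndependent : ∀ {m n} → (Fin m → Vector ℝ n) → Set
LinearlyIndependent {m} v =
  ∀ (c : Vector ℝ m) → (∀ i → sum (λ k → c k * v k i) ≃ 0ℝ) → ∀ k → c k ≃ 0ℝ

-- n linearly independent vectors of ℝⁿ form a basis, so for a
-- diagonalisable matrix (in particular a symmetric one) this says that
-- eig lists all the eigenvalues in weakly decreasing order, each repeated
-- as often as the dimension of its eigenspace.
record IsSpectrum {n} (A : Matrix n) (eig : Fin n → ℝ) : Set where
  field
    decreasing  : ∀ i j → i Fin.≤ j → eig j ≤ eig i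
    vec         : Fin n → Vector ℝ n
    independent : LinearlyIndependent vec
    eigen       : ∀ k i → (A · vec k) i ≃ eig k * vec k i

-- Positions are counted from 0, so the second largest eigenvalue is the
-- one at position 1.
IsSecondLargestEigenvalue : ∀ {n} → Matrix n → ℝ → Set
IsSecondLargestEigenvalue {n} A μ =
  ∃[ eig ] IsSpectrum A eig × (∃[ k ] toℕ {n} k ≡ 1 × μ ≃ eig k)

record Graph (n : ℕ) : Set where
  field
    adj         : Fin n → Fin n → Bool
    symmetric   : ∀ u v → adj u v ≡ adj v u
    irreflexive : ∀ v → adj v v ≡ false

open Graph public

adjacencyMatrix : ∀ {n} → Graph n → Matrix n
adjacencyMatrix G u v = if adj G u v then 1ℝ else 0ℝ

Isλ₂ : ∀ {n} → Graph n → ℝ → Set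
Isλ₂ G = IsSecondLargestEigenvalue (adjacencyMatrix G)

data Walk {n} (G : Graph n) : Fin n → Fin n → ℕ → Set where
  []  : ∀ {u} → Walk G u u 0
  _∷_ : ∀ {u v w k} → adj G u v ≡ true → Walk G v w k → Walk G u w (suc k)

Connected : ∀ {n} → Graph n → Set
Connected {n} G = 1 ℕ.≤ n × (∀ u v → ∃[ k ] Walk G u v k)

-- A cycle through the distinct vertices c 0, …, c (2 + k).
record Cycle {n} (G : Graph n) : Set where
  field
    {k}      : ℕ
    c        : Fin (suc (suc (suc k))) → Fin n
    distinct : Injective _≡_ _≡_ c
    step     : ∀ i → adj G (c (inject₁ i)) (c (suc i)) ≡ true
    close    : adj G (c (fromℕ (suc (suc k)))) (c zero) ≡ true

IsTree : ∀ {n} → Graph n → Set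
IsTree G = Connected G × ¬ Cycle G

IsDistance : ∀ {n} → Graph n → Fin n → Fin n → ℕ → Set
IsDistance G u v k = Walk G u v k × (∀ l → Walk G u v l → k ℕ.≤ l)

HasDiameter : ∀ {n} → Graph n → ℕ → Set
HasDiameter G d =
  (∃[ u ] ∃[ v ] IsDistance G u v d) ×
  (∀ u v k → IsDistance G u v k → k ℕ.≤ d)

-- Membership of T in 𝒯(n, d); the vertex set is Fin n.
InTreeClass : ∀ {n} → ℕ → Graph n → Set
InTreeClass d T = IsTree T × HasDiameter T d

IsMaximum : (ℝ → Set) → ℝ → Set
IsMaximum S m = (∃[ x ] S x × m ≃ x) × (∀ x → S x → x ≤ m)

IsMaxλ₂ : ℕ → ℕ → ℝ → Set
IsMaxλ₂ n d = IsMaximum (λ μ → Σ (Graph n) λ T → InTreeClass d T × Isλ₂ T μ)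

-- If some vertex v is such that the quadratic form ⟨x, A x⟩ is at most ℓ ⟨x, x⟩
-- whenever x v = 0, then λ₂ ≤ ℓ, because the span of the first two eigenvectors
-- contains a nonzero x with x v = 0.  Root the tree at one end of a diametral
-- path, let b be the other end, and let k = n - d - 1 be the number of vertices
-- off the path.  Take for v a deepest vertex below which (inclusive) lie at
-- least k/2 of them; then every component of T - v has at most k/2 off-path
-- vertices.  On such a component the form is bounded edge by edge,
--   2 ℓ x_c x_u ≤ C_c x_c² + F_c x_u²   (u the parent of c),
-- with explicit weights F_c C_c ≥ ℓ² that add up to ℓ² at every vertex.  They
-- exist as soon as (ℓ² - 2)² ≥ (k/2)² + 4.  As k/2 = (n - d)/2 - 1/2, there is
-- slack for a rational ℓ that satisfies this and lies strictly below
-- √(2 + √(((n - d)/2)² + 4)), so a negative statement, λ₂ ≤ ℓ, suffices to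
-- obtain the constructively stronger strict inequality.
module Submission where

open import Defs hiding (_+_; _*_; _<_; _≤_; sum)
open import Level using (0ℓ)
open import Algebra.Bundles using (CommutativeRing)
import Algebra.Properties.Semiring.Sum as SemiringSum
open import Data.Bool using (Bool; true; false; _∧_; _∨_; not; if_then_else_)
import Data.Bool.Properties as Bool
open import Data.Fin using (Fin; zero; suc; _≟_; fromℕ; inject₁)
import Data.Fin.Properties as Fin
import Data.Integer as ℤ
import Data.Integer.Solver as ℤ
open import Data.Nat as ℕ using (ℕ; zero; suc; _⊔_; _∸_; z≤n; s≤s)
import Data.Nat.Properties as ℕ
open import Data.Product using (∃; ∃-syntax; _×_; _,_; proj₁; proj₂)
open import Data.Rational as ℚ using (ℚ; 0ℚ; 1ℚ; ½)
import Data.Rational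
import Data.Rational.Properties as ℚ
open import Data.Rational.Solver using (module +-*-Solver)
import Data.Rational.Unnormalised as ℚᵘ
import Data.Rational.Unnormalised.Properties as ℚᵘ
open import Data.Sum using (_⊎_; inj₁; inj₂)
open import Data.Vec.Functional using (Vector)
open import Function using (_∘_; case_of_)
open import Relation.Binary using (Setoid)
open import Relation.Binary.PropositionalEquality hiding (isEquivalence)
import Relation.Binary.Reasoning.Setoid as SetoidReasoning
open import Relation.Nullary using (¬_; Dec; yes; no; does; contradiction)
open import Relation.Nullary.Decidable using (_×-dec_; ¬?; dec-true; dec-false; map′)
open +-*-Solver using (solve; _:=_; _:+_; _:*_; _:-_; con)

-- Rational inequalities, finite sums and indicators.

module ∑ = SemiringSum (CommutativeRing.semiring ℚ.+-*-commutativeRing)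

module _ where
  open Data.Rational using (_+_; _*_; _-_; _≤_; _<_)

  0≤+ : ∀ {p q} → 0ℚ ≤ p → 0ℚ ≤ q → 0ℚ ≤ p + q
  0≤+ = ℚ.+-mono-≤

  0≤* : ∀ {p q} → 0ℚ ≤ p → 0ℚ ≤ q → 0ℚ ≤ p * q
  0≤* {p} {q} 0≤p 0≤q = ℚ.nonNegative⁻¹ (p * q)
    {{ℚ.nonNeg*nonNeg⇒nonNeg p {{ℚ.nonNegative 0≤p}} q {{ℚ.nonNegative 0≤q}}}}

  0<* : ∀ {p q} → 0ℚ < p → 0ℚ < q → 0ℚ < p * q
  0<* {p} {q} 0<p 0<q = ℚ.positive⁻¹ (p * q)
    {{ℚ.pos*pos⇒pos p {{ℚ.positive 0<p}} q {{ℚ.positive 0<q}}}}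

  ≤⇒0≤ : ∀ {p q} → p ≤ q → 0ℚ ≤ q - p
  ≤⇒0≤ {p} {q} p≤q = subst (_≤ q - p) (ℚ.+-inverseʳ p) (ℚ.+-monoˡ-≤ (ℚ.- p) p≤q)

  <⇒0< : ∀ {p q} → p < q → 0ℚ < q - p
  <⇒0< {p} {q} p<q = subst (_< q - p) (ℚ.+-inverseʳ p) (ℚ.+-monoˡ-< (ℚ.- p) p<q)

  -- Inequalities are proved by exhibiting the difference as a manifestly
  -- non-negative expression and leaving the identity to the ring solver.
  ≤-by : ∀ {p q e} → 0ℚ ≤ e → q ≡ p + e → p ≤ q
  ≤-by {p} 0≤e q≡p+e =
    subst₂ _≤_ (ℚ.+-identityʳ p) (sym q≡p+e) (ℚ.+-monoʳ-≤ p 0≤e)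

  <-by : ∀ {p q e} → 0ℚ < e → q ≡ p + e → p < q
  <-by {p} 0<e q≡p+e =
    subst₂ _<_ (ℚ.+-identityʳ p) (sym q≡p+e) (ℚ.+-monoʳ-< p 0<e)

  0≤² : ∀ p → 0ℚ ≤ p * p
  0≤² p with ℚ.≤-total 0ℚ p
  ... | inj₁ 0≤p = 0≤* 0≤p 0≤p
  ... | inj₂ p≤0 = subst (0ℚ ≤_)
    (solve 1 (λ p → (con 0ℚ :- p) :* (con 0ℚ :- p) := p :* p) refl p)
    (0≤* (≤⇒0≤ p≤0) (≤⇒0≤ p≤0))

  sum-mono-≤ : ∀ {n} {f g : Fin n → ℚ} → (∀ i → f i ≤ g i) → ∑.sum f ≤ ∑.sum g
  sum-mono-≤ {zero}  f≤g = ℚ.≤-refl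
  sum-mono-≤ {suc n} f≤g = ℚ.+-mono-≤ (f≤g zero) (sum-mono-≤ (λ i → f≤g (suc i)))

  0≤sum : ∀ {n} {f : Fin n → ℚ} → (∀ i → 0ℚ ≤ f i) → 0ℚ ≤ ∑.sum f
  0≤sum {zero}  0≤f = ℚ.≤-refl
  0≤sum {suc n} 0≤f = 0≤+ (0≤f zero) (0≤sum (λ i → 0≤f (suc i)))

  term≤sum : ∀ {n} {f : Fin n → ℚ} → (∀ i → 0ℚ ≤ f i) → ∀ i → f i ≤ ∑.sum f
  term≤sum {suc n} {f} 0≤f zero    = ≤-by (0≤sum (λ i → 0≤f (suc i))) refl
  term≤sum {suc n} {f} 0≤f (suc i) = ℚ.≤-trans (term≤sum (λ i → 0≤f (suc i)) i)
    (≤-by (0≤f zero) (ℚ.+-comm (f zero) _))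

  𝟙 : ∀ {P : Set} → Dec P → ℚ
  𝟙 P? = if does P? then 1ℚ else 0ℚ

  𝟙-true : ∀ {P : Set} (P? : Dec P) → P → 𝟙 P? ≡ 1ℚ
  𝟙-true P? p = cong (if_then 1ℚ else 0ℚ) (dec-true P? p)

  𝟙-false : ∀ {P : Set} (P? : Dec P) → ¬ P → 𝟙 P? ≡ 0ℚ
  𝟙-false P? ¬p = cong (if_then 1ℚ else 0ℚ) (dec-false P? ¬p)

  0≤1 : 0ℚ ≤ 1ℚ
  0≤1 = ℚ.nonNegative⁻¹ 1ℚ

  0≤𝟙 : ∀ {P : Set} (P? : Dec P) → 0ℚ ≤ 𝟙 P?
  0≤𝟙 (yes _) = 0≤1
  0≤𝟙 (no  _) = ℚ.≤-refl

  𝟙≤1 : ∀ {P : Set} (P? : Dec P) → 𝟙 P? ≤ 1ℚ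
  𝟙≤1 (yes _) = ℚ.≤-refl
  𝟙≤1 (no  _) = 0≤1

  sum-𝟙≟ : ∀ {n} (i : Fin n) (f : Fin n → ℚ) → ∑.sum (λ j → 𝟙 (j ≟ i) * f j) ≡ f i
  sum-𝟙≟ {suc n} zero f = trans
    (cong₂ _+_ (ℚ.*-identityˡ (f zero))
      (trans (∑.sum-cong-≗ (λ j → ℚ.*-zeroˡ (f (suc j)))) (∑.sum-replicate-zero n)))
    (ℚ.+-identityʳ (f zero))
  sum-𝟙≟ {suc n} (suc i) f = trans
    (cong₂ _+_ (ℚ.*-zeroˡ (f zero)) (sum-𝟙≟ i (λ j → f (suc j))))
    (ℚ.+-identityˡ (f (suc i)))

  sum-𝟙≟-1 : ∀ {n} (i : Fin n) → ∑.sum (λ j → 𝟙 (j ≟ i)) ≡ 1ℚ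
  sum-𝟙≟-1 i = trans
    (∑.sum-cong-≗ (λ j → sym (ℚ.*-identityʳ (𝟙 (j ≟ i))))) (sum-𝟙≟ i (λ _ → 1ℚ))

  sum-0 : ∀ {n} {f : Fin n → ℚ} → (∀ i → f i ≡ 0ℚ) → ∑.sum f ≡ 0ℚ
  sum-0 {n} f≡0 = trans (∑.sum-cong-≗ f≡0) (∑.sum-replicate-zero n)

-- Rooted trees

argmax : ∀ {n} {P : Fin n → Set} (P? : ∀ i → Dec (P i)) (f : Fin n → ℕ) →
  ∃ P → ∃[ i ] P i × (∀ j → P j → f j ℕ.≤ f i)
argmax {suc n} {P} P? f (i₀ , Pi₀) with P? zero | Fin.any? (P? ∘ suc)
... | P0 | no ¬P = zero , P0′ i₀ Pi₀ , λ where
      zero    _   → ℕ.≤-refl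
      (suc j) Pj  → contradiction (j , Pj) ¬P
  where
  P0′ : ∀ i → P i → P zero
  P0′ zero    p = p
  P0′ (suc i) p = contradiction (i , p) ¬P
... | no ¬P0 | yes P+ =
  let i , Pi , max = argmax (P? ∘ suc) (f ∘ suc) P+ in
  suc i , Pi , λ where
    zero    P0 → contradiction P0 ¬P0
    (suc j) Pj → max j Pj
... | yes P0 | yes P+ with argmax (P? ∘ suc) (f ∘ suc) P+
... | i , Pi , max with ℕ.≤-total (f zero) (f (suc i))
... | inj₁ 0≤i = suc i , Pi , λ { zero _ → 0≤i ; (suc j) Pj → max j Pj }
... | inj₂ i≤0 = zero , P0 , λ { zero _ → ℕ.≤-refl ; (suc j) Pj → ℕ.≤-trans (max j Pj) i≤0 }

-- `par root` is an arbitrary value, so the tree relations below ask for `w ≢ root`. `depth` is what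
-- makes climbing along `par` terminate.
record RootedTree (n : ℕ) : Set where
  field
    root      : Fin n
    par       : Fin n → Fin n
    depth     : Fin n → ℕ
    depth-root : depth root ≡ 0
    depth-par : ∀ {w} → w ≢ root → suc (depth (par w)) ≡ depth w

module Ancestors {n} (T : RootedTree n) where
  open RootedTree T
  open Data.Rational using (_+_; _*_; _-_; _≤_; _<_)

  infix 4 _≼_ _≼?_

  data _≼_ (u : Fin n) : Fin n → Set where
    here : u ≼ u
    up   : ∀ {w} → w ≢ root → u ≼ par w → u ≼ w

  IsChild : Fin n → Fin n → Set
  IsChild c u = c ≢ root × par c ≡ u

  abstract
    isChild? : ∀ c u → Dec (IsChild c u)
    isChild? c u = ¬? (c ≟ root) ×-dec (par c ≟ u)

  -- Induction from the root downwards. The recursion runs on `depth`, since `par w` is not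
  -- structurally smaller than `w`.
  climb : ∀ {P : Fin n → Set} → P root →
    (∀ {w} → w ≢ root → P (par w) → P w) → ∀ w → P w
  climb {P} base step w = go (depth w) w refl
    where
    go : ∀ k w → depth w ≡ k → P w
    go k w eq with w ≟ root
    ... | yes refl = base
    go zero w eq | no w≢ = contradiction (trans (depth-par w≢) eq) λ ()
    go (suc k) w eq | no w≢ = step w≢ (go k (par w) (ℕ.suc-injective (trans (depth-par w≢) eq)))

  ≼-par : ∀ {u w} → u ≼ w → u ≢ w → w ≢ root × u ≼ par w
  ≼-par here       u≢w = contradiction refl u≢w
  ≼-par (up w≢ u≼) u≢w = w≢ , u≼

  -- Kept opaque: later proofs only split on the decision or evaluate its indicator through `𝟙-true`
  -- and `𝟙-false`.
  abstract
    _≼?_ : ∀ u w → Dec (u ≼ w)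
    u ≼? w = climb {λ w → Dec (u ≼ w)} base step w
      where
      base : Dec (u ≼ root)
      base with u ≟ root
      ... | yes refl = yes here
      ... | no u≢    = no λ u≼ → proj₁ (≼-par u≼ u≢) refl
      step : ∀ {w} → w ≢ root → Dec (u ≼ par w) → Dec (u ≼ w)
      step w≢ (yes u≼) = yes (up w≢ u≼)
      step {w} w≢ (no u⋠) with u ≟ w
      ... | yes refl = yes here
      ... | no u≢w   = no λ u≼w → u⋠ (proj₂ (≼-par u≼w u≢w))

  depth-par< : ∀ {w} → w ≢ root → depth (par w) ℕ.< depth w
  depth-par< w≢ = ℕ.≤-reflexive (depth-par w≢)

  ≼⇒depth≤ : ∀ {u w} → u ≼ w → depth u ℕ.≤ depth w
  ≼⇒depth≤ here       = ℕ.≤-refl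
  ≼⇒depth≤ (up w≢ u≼) = ℕ.≤-trans (≼⇒depth≤ u≼) (ℕ.<⇒≤ (depth-par< w≢))

  ≼∧depth≥⇒≡ : ∀ {u w} → u ≼ w → depth w ℕ.≤ depth u → u ≡ w
  ≼∧depth≥⇒≡ here       _  = refl
  ≼∧depth≥⇒≡ (up w≢ u≼) w≤u = contradiction
    (ℕ.<-≤-trans (ℕ.≤-<-trans (≼⇒depth≤ u≼) (depth-par< w≢)) w≤u) (ℕ.<-irrefl refl)

  ≼-trans : ∀ {u v w} → u ≼ v → v ≼ w → u ≼ w
  ≼-trans u≼v here        = u≼v
  ≼-trans u≼v (up w≢ v≼) = up w≢ (≼-trans u≼v v≼)

  -- The ancestors of `w` form a chain. Both derivations climb from `w` in step; should the one for
  -- `u` end first, the depths force `u` and `v` to be equal.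
  ≼-linear : ∀ {u v w} → u ≼ w → v ≼ w → depth u ℕ.≤ depth v → u ≼ v
  ≼-linear u≼w here u≤v = u≼w
  ≼-linear here v≼w@(up _ _) u≤v = subst (_ ≼_) (sym (≼∧depth≥⇒≡ v≼w u≤v)) here
  ≼-linear (up _ u≼) (up _ v≼) u≤v = ≼-linear u≼ v≼ u≤v

  root≼ : ∀ w → root ≼ w
  root≼ = climb here up

  child-≼ : ∀ {c u} → IsChild c u → u ≼ c
  child-≼ (c≢ , refl) = up c≢ here

  child-depth : ∀ {c u} → IsChild c u → depth c ≡ suc (depth u)
  child-depth (c≢ , refl) = sym (depth-par c≢)

  child-⋠ : ∀ {c u} → IsChild c u → ¬ c ≼ u
  child-⋠ {u = u} ch c≼u =
    ℕ.1+n≰n (subst (ℕ._≤ depth u) (child-depth ch) (≼⇒depth≤ c≼u))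

  branch : ∀ {u w} → u ≼ w → u ≢ w → ∃[ c ] IsChild c u × c ≼ w
  branch here u≢w = contradiction refl u≢w
  branch {u} {w} (up w≢ u≼) _ with u ≟ par w
  ... | yes refl = w , (w≢ , refl) , here
  ... | no u≢    = let c , ch , c≼ = branch u≼ u≢ in c , ch , up w≢ c≼

  branch-unique : ∀ {u w c c′} → IsChild c u → IsChild c′ u → c ≼ w → c′ ≼ w → c ≡ c′
  branch-unique ch ch′ c≼ c′≼ = ≼∧depth≥⇒≡
    (≼-linear c≼ c′≼ (ℕ.≤-reflexive (trans (child-depth ch) (sym (child-depth ch′)))))
    (ℕ.≤-reflexive (trans (child-depth ch′) (sym (child-depth ch))))

  anc child : Fin n → Fin n → ℚ
  anc u w = 𝟙 (u ≼? w)
  child c u = 𝟙 (isChild? c u)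

  anc-par : ∀ u {w} → w ≢ root → anc u w ≡ 𝟙 (u ≟ w) + anc u (par w)
  anc-par u {w} w≢ with u ≟ w
  ... | yes refl = trans (𝟙-true (u ≼? w) here)
    (cong (1ℚ +_) (sym (𝟙-false (u ≼? par w) (child-⋠ (w≢ , refl)))))
  ... | no u≢w with u ≼? par w
  ... | yes u≼ = 𝟙-true (u ≼? w) (up w≢ u≼)
  ... | no u⋠  = 𝟙-false (u ≼? w) λ u≼w → u⋠ (proj₂ (≼-par u≼w u≢w))

  -- By `branch` and `branch-unique` a proper descendant of `u` lies below exactly one child of `u`,
  -- so the sum then has a single nonzero term. If `w` is `u` or is not below `u`, every term
  -- vanishes.
  anc-children : ∀ u w → anc u w ≡ 𝟙 (u ≟ w) + ∑.sum (λ c → child c u * anc c w)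
  anc-children u w with u ≟ w
  ... | yes refl = trans (𝟙-true (u ≼? u) here)
    (cong (1ℚ +_) (sym (sum-0 vanish)))
    where
    vanish : ∀ c → child c u * anc c u ≡ 0ℚ
    vanish c with isChild? c u
    ... | yes ch = trans (ℚ.*-identityˡ _) (𝟙-false (c ≼? u) (child-⋠ ch))
    ... | no _   = ℚ.*-zeroˡ (anc c u)
  ... | no u≢w with u ≼? w
  ... | no u⋠w = sym (cong (0ℚ +_) (sum-0 vanish))
    where
    vanish : ∀ c → child c u * anc c w ≡ 0ℚ
    vanish c with isChild? c u
    ... | yes ch = trans (ℚ.*-identityˡ _)
      (𝟙-false (c ≼? w) λ c≼w → u⋠w (≼-trans (child-≼ ch) c≼w))
    ... | no _   = ℚ.*-zeroˡ (anc c w)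
  ... | yes u≼w = sym (trans (ℚ.+-identityˡ (∑.sum (λ c → child c u * anc c w)))
    (trans (∑.sum-cong-≗ only) (sum-𝟙≟-1 c₀)))
    where
    c₀ = proj₁ (branch u≼w u≢w)
    ch₀ = proj₁ (proj₂ (branch u≼w u≢w))
    c₀≼w = proj₂ (proj₂ (branch u≼w u≢w))
    only : ∀ c → child c u * anc c w ≡ 𝟙 (c ≟ c₀)
    only c with c ≟ c₀
    ... | yes refl = cong₂ _*_ (𝟙-true (isChild? c₀ u) ch₀) (𝟙-true (c₀ ≼? w) c₀≼w)
    ... | no c≢ with isChild? c u
    ... | no _ = ℚ.*-zeroˡ (anc c w)
    ... | yes ch = trans (ℚ.*-identityˡ (anc c w))
      (𝟙-false (c ≼? w) λ c≼w → c≢ (branch-unique ch ch₀ c≼w c₀≼w))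

  below : (Fin n → ℚ) → Fin n → ℚ
  below f u = ∑.sum (λ w → anc u w * f w)

  -- The recursion of subtree sums: `anc-children` weighted by `f`, then an exchange of summations.
  -- It makes the weights at a vertex add up in `upper`.
  below-children : ∀ f u → below f u ≡ f u + ∑.sum (λ c → child c u * below f c)
  below-children f u = begin
    ∑.sum (λ w → anc u w * f w)
      ≡⟨ ∑.sum-cong-≗ expand ⟩
    ∑.sum (λ w → 𝟙 (w ≟ u) * f w + ∑.sum (λ c → child c u * (anc c w * f w)))
      ≡⟨ ∑.∑-distrib-+ (λ w → 𝟙 (w ≟ u) * f w) (λ w → ∑.sum (λ c → child c u * (anc c w * f w))) ⟩
    ∑.sum (λ w → 𝟙 (w ≟ u) * f w) + ∑.sum (λ w → ∑.sum (λ c → child c u * (anc c w * f w)))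
      ≡⟨ cong₂ _+_ (sum-𝟙≟ u f) (∑.∑-comm (λ w c → child c u * (anc c w * f w))) ⟩
    f u + ∑.sum (λ c → ∑.sum (λ w → child c u * (anc c w * f w)))
      ≡⟨ cong (f u +_) (∑.sum-cong-≗ λ c → sym (∑.*-distribˡ-sum (child c u) (λ w → anc c w * f w))) ⟩
    f u + ∑.sum (λ c → child c u * below f c) ∎
    where
    open ≡-Reasoning
    𝟙-sym : ∀ (i j : Fin n) → 𝟙 (i ≟ j) ≡ 𝟙 (j ≟ i)
    𝟙-sym i j with j ≟ i
    ... | yes j≡i = 𝟙-true (i ≟ j) (sym j≡i)
    ... | no j≢i  = 𝟙-false (i ≟ j) (j≢i ∘ sym)
    expand : ∀ w → anc u w * f w ≡
      𝟙 (w ≟ u) * f w + ∑.sum (λ c → child c u * (anc c w * f w))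
    expand w = begin
      anc u w * f w
        ≡⟨ cong (_* f w) (trans (anc-children u w) (cong (_+ ∑.sum (λ c → child c u * anc c w)) (𝟙-sym u w))) ⟩
      (𝟙 (w ≟ u) + ∑.sum (λ c → child c u * anc c w)) * f w
        ≡⟨ ℚ.*-distribʳ-+ (f w) (𝟙 (w ≟ u)) _ ⟩
      𝟙 (w ≟ u) * f w + ∑.sum (λ c → child c u * anc c w) * f w
        ≡⟨ cong (𝟙 (w ≟ u) * f w +_) (trans (∑.*-distribʳ-sum (f w) (λ c → child c u * anc c w))
             (∑.sum-cong-≗ λ c → ℚ.*-assoc (child c u) (anc c w) (f w))) ⟩
      𝟙 (w ≟ u) * f w + ∑.sum (λ c → child c u * (anc c w * f w)) ∎

  -- A vertex other than the root has one parent and the root has none, so the sum is 1 or 0.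
  sum-child≤1 : ∀ c → ∑.sum (child c) ≤ 1ℚ
  sum-child≤1 c = subst (∑.sum (child c) ≤_) (sum-𝟙≟-1 (par c)) (sum-mono-≤ le)
    where
    le : ∀ u → child c u ≤ 𝟙 (u ≟ par c)
    le u with isChild? c u
    ... | yes (_ , refl) = ℚ.≤-reflexive (sym (𝟙-true (par c ≟ par c) refl))
    ... | no _           = 0≤𝟙 (u ≟ par c)

-- The weight certificate

2ℚ 4ℚ : ℚ
2ℚ = 1ℚ ℚ.+ 1ℚ
4ℚ = 2ℚ ℚ.+ 2ℚ

module _ where
  open Data.Rational using (_+_; _*_; _-_; _≤_; _<_)

  square-cancel-≤ : ∀ {p q} → 0ℚ ≤ q → p * p ≤ q * q → p ≤ q
  square-cancel-≤ {p} {q} 0≤q p²≤q² with p ℚ.≤? q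
  ... | yes p≤q = p≤q
  ... | no p≰q  = contradiction (ℚ.<-≤-trans q²<p² p²≤q²) (ℚ.<-irrefl refl)
    where
    q<p = ℚ.≰⇒> p≰q
    q²<p² : q * q < p * p
    q²<p² = <-by (0<* (<⇒0< q<p) (ℚ.+-mono-<-≤ (ℚ.≤-<-trans 0≤q q<p) 0≤q))
      (solve 2 (λ p q → p :* p := q :* q :+ (p :- q) :* (p :+ q)) refl p q)

  -- After multiplication by `F` the two sides differ by `(F C - ℓ²) x² + (ℓ x - F y)²`.
  weighted-AM-GM : ∀ {ℓ C F} → 0ℚ < F → ℓ * ℓ ≤ F * C → ∀ x y →
    ℓ * (x * y + x * y) ≤ C * (x * x) + F * (y * y)
  weighted-AM-GM {ℓ} {C} {F} 0<F ℓ²≤FC x y =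
    ℚ.*-cancelˡ-≤-pos F {{ℚ.positive 0<F}}
      (≤-by (0≤+ (0≤* (≤⇒0≤ ℓ²≤FC) (0≤² x)) (0≤² (ℓ * x - F * y)))
        (solve 5 (λ ℓ C F x y → F :* (C :* (x :* x) :+ F :* (y :* y)) :=
            F :* (ℓ :* (x :* y :+ x :* y)) :+
            ((F :* C :- ℓ :* ℓ) :* (x :* x) :+
             (ℓ :* x :- F :* y) :* (ℓ :* x :- F :* y)))
          refl ℓ C F x y))

  -- The path joining root and b consists of the ancestors of b.
  module Certificate {n} (T : RootedTree n) (b : Fin n) where
    open RootedTree T
    open Ancestors T

    off : Fin n → ℚ
    off w = 1ℚ - anc w b

    total half : ℚ
    total = ∑.sum off
    half  = ½ * total

    mass : Fin n → ℚ
    mass = below off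

    0≤off : ∀ w → 0ℚ ≤ off w
    0≤off w = ≤⇒0≤ (𝟙≤1 (w ≼? b))

    0≤total : 0ℚ ≤ total
    0≤total = 0≤sum 0≤off

    0≤half : 0ℚ ≤ half
    0≤half = 0≤* (ℚ.nonNegative⁻¹ ½) 0≤total

    mass-root : mass root ≡ total
    mass-root = ∑.sum-cong-≗ λ w →
      trans (cong (_* off w) (𝟙-true (root ≼? w) (root≼ w))) (ℚ.*-identityˡ (off w))

    below-mono : ∀ {f g : Fin n → ℚ} → (∀ w → f w ≤ g w) → ∀ w → f w * off w ≤ g w * off w
    below-mono f≤g w = ℚ.*-monoʳ-≤-nonNeg (off w) {{ℚ.nonNegative (0≤off w)}} (f≤g w)

    0≤mass : ∀ u → 0ℚ ≤ mass u
    0≤mass u = 0≤sum λ w → 0≤* (0≤𝟙 (u ≼? w)) (0≤off w)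

    mass≤total : ∀ u → mass u ≤ total
    mass≤total u = sum-mono-≤ λ w → ℚ.≤-trans
      (below-mono (λ w → 𝟙≤1 (u ≼? w)) w) (ℚ.≤-reflexive (ℚ.*-identityˡ (off w)))

    Heavy : Fin n → Set
    Heavy u = total ≤ mass u + mass u

    -- The root qualifies, because its subtree carries all of `total`, so `argmax` has a candidate.
    deepest-heavy : ∃[ v ] Heavy v × (∀ u → Heavy u → depth u ℕ.≤ depth v)
    deepest-heavy = argmax (λ u → total ℚ.≤? (mass u + mass u)) depth
      (root , subst (λ m → total ≤ m + m) (sym mass-root) (≤-by 0≤total refl))

  module Cut {n} (T : RootedTree n) (b v : Fin n)
    (heavy : Certificate.Heavy T b v)
    (deepest : ∀ u → Certificate.Heavy T b u → RootedTree.depth T u ℕ.≤ RootedTree.depth T v) where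
    open RootedTree T
    open Ancestors T
    open Certificate T b

    light : ∀ {u} → depth v ℕ.< depth u → mass u + mass u ≤ total
    light {u} v<u = ℚ.<⇒≤ (ℚ.≰⇒> λ h →
      ℕ.<-irrefl refl (ℕ.<-≤-trans v<u (deepest u h)))

    mass-≼ : ∀ {u} → u ≼ v → mass v ≤ mass u
    mass-≼ {u} u≼v = sum-mono-≤ (below-mono le)
      where
      le : ∀ w → anc v w ≤ anc u w
      le w with v ≼? w
      ... | no _    = 0≤𝟙 (u ≼? w)
      ... | yes v≼w = ℚ.≤-reflexive (sym (𝟙-true (u ≼? w) (≼-trans u≼v v≼w)))

    -- The subtrees of `u` and `v` are disjoint: given a common descendant, `≼-linear` would put `u`
    -- above `v`.
    mass-disjoint : ∀ {u} → depth u ℕ.≤ depth v → ¬ u ≼ v → mass u + mass v ≤ total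
    mass-disjoint {u} u≤v u⋠v = subst (_≤ total)
      (∑.∑-distrib-+ (λ w → anc u w * off w) (λ w → anc v w * off w))
      (sum-mono-≤ λ w → subst₂ _≤_ (ℚ.*-distribʳ-+ (off w) (anc u w) (anc v w))
        (ℚ.*-identityˡ (off w)) (below-mono le w))
      where
      le : ∀ w → anc u w + anc v w ≤ 1ℚ
      le w with u ≼? w
      ... | no _ = ℚ.≤-trans (ℚ.≤-reflexive (ℚ.+-identityˡ (anc v w))) (𝟙≤1 (v ≼? w))
      ... | yes u≼w = ℚ.≤-reflexive (cong (1ℚ +_)
        (𝟙-false (v ≼? w) λ v≼w → u⋠v (≼-linear u≼w v≼w u≤v)))

    mass-self : ∀ {u} → ¬ u ≼ b → 1ℚ ≤ mass u
    mass-self {u} u⋠b = subst (_≤ mass u)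
      (cong₂ (λ p q → p * (1ℚ - q)) (𝟙-true (u ≼? u) here) (𝟙-false (u ≼? b) u⋠b))
      (term≤sum (λ w → 0≤* (0≤𝟙 (u ≼? w)) (0≤off w)) u)

    -- As a proper ancestor of `v`, `u` is itself an off-path vertex that `mass u` counts and
    -- `mass v` does not.
    mass-step : ∀ {u} → u ≼ v → u ≢ v → ¬ u ≼ b → 1ℚ + mass v ≤ mass u
    mass-step {u} u≼v u≢v u⋠b = subst (_≤ mass u)
      (trans (∑.∑-distrib-+ (λ w → 𝟙 (w ≟ u) * off w) (λ w → anc v w * off w))
        (cong (_+ mass v) (trans (sum-𝟙≟ u off) (cong (1ℚ -_) (𝟙-false (u ≼? b) u⋠b)))))
      (sum-mono-≤ λ w → subst (_≤ anc u w * off w)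
        (ℚ.*-distribʳ-+ (off w) (𝟙 (w ≟ u)) (anc v w)) (below-mono le w))
      where
      le : ∀ w → 𝟙 (w ≟ u) + anc v w ≤ anc u w
      le w with w ≟ u
      ... | yes refl = ℚ.≤-reflexive (trans (cong (1ℚ +_) (𝟙-false (v ≼? w) v⋠u))
                                            (sym (𝟙-true (w ≼? w) here)))
        where
        v⋠u : ¬ v ≼ w
        v⋠u v≼u = u≢v (≼∧depth≥⇒≡ u≼v (≼⇒depth≤ v≼u))
      ... | no _ with v ≼? w
      ... | no _    = 0≤𝟙 (u ≼? w)
      ... | yes v≼w = ℚ.≤-reflexive (sym (𝟙-true (u ≼? w) (≼-trans u≼v v≼w)))

    -- The number of vertices off the path in that part of T - v which lies
    -- below u; it is 0 for u = v.
    side : Fin n → ℚ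
    side u = mass u - anc u v * mass v

    side-≼ : ∀ {u} → u ≼ v → side u ≡ mass u - mass v
    side-≼ {u} u≼v = cong (mass u -_)
      (trans (cong (_* mass v) (𝟙-true (u ≼? v) u≼v)) (ℚ.*-identityˡ (mass v)))

    side-⋠ : ∀ {u} → ¬ u ≼ v → side u ≡ mass u
    side-⋠ {u} u⋠v = trans (cong (λ t → mass u - t * mass v) (𝟙-false (u ≼? v) u⋠v))
      (solve 2 (λ m k → m :- con 0ℚ :* k := m) refl (mass u) (mass v))

    0≤side : ∀ u → 0ℚ ≤ side u
    0≤side u = case u ≼? v of λ where
      (yes u≼v) → subst (0ℚ ≤_) (sym (side-≼ u≼v)) (≤⇒0≤ (mass-≼ u≼v))
      (no u⋠v) → subst (0ℚ ≤_) (sym (side-⋠ u⋠v)) (0≤mass u)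

    1≤side : ∀ {u} → u ≢ v → ¬ u ≼ b → 1ℚ ≤ side u
    1≤side {u} u≢v u⋠b = case u ≼? v of λ where
      (yes u≼v) → subst (1ℚ ≤_) (sym (side-≼ u≼v))
          (≤-by (≤⇒0≤ (mass-step u≼v u≢v u⋠b))
            (solve 2 (λ m k → m :- k := con 1ℚ :+ (m :- (con 1ℚ :+ k))) refl (mass u) (mass v)))
      (no u⋠v) → subst (1ℚ ≤_) (sym (side-⋠ u⋠v)) (mass-self u⋠b)

    halve : ∀ {p} → p + p ≤ total → p ≤ half
    halve {p} 2p≤t = ≤-by (0≤* (ℚ.nonNegative⁻¹ ½) (≤⇒0≤ 2p≤t))
      (solve 2 (λ p t → con ½ :* t := p :+ con ½ :* (t :- (p :+ p))) refl p total)

    -- Above `v`, the heavy subtree of `v` is taken away and at most half of the total remains.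
    -- Deeper than `v`, every vertex is light. In the remaining case the subtree of `u` is disjoint
    -- from that of `v`, which already holds half.
    side≤half : ∀ {u} → u ≢ v → side u ≤ half
    side≤half {u} u≢v = case u ≼? v of λ where
      (yes u≼v) → subst (_≤ half) (sym (side-≼ u≼v)) (halve
        (≤-by (0≤+ (0≤+ (≤⇒0≤ heavy) (≤⇒0≤ (mass≤total u))) (≤⇒0≤ (mass≤total u)))
          (solve 3 (λ m k t → t := ((m :- k) :+ (m :- k)) :+
              (((k :+ k) :- t) :+ (t :- m) :+ (t :- m))) refl (mass u) (mass v) total)))
      (no u⋠v) → subst (_≤ half) (sym (side-⋠ u⋠v)) (halve
        (case ℕ.<-≤-connex (depth v) (depth u) of λ where
          (inj₁ v<u) → light v<u
          (inj₂ u≤v) → let d = mass-disjoint u≤v u⋠v in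
            ≤-by (0≤+ (0≤+ (≤⇒0≤ heavy) (≤⇒0≤ d)) (≤⇒0≤ d))
              (solve 3 (λ m k t → t := (m :+ m) :+
                  (((k :+ k) :- t) :+ (t :- (m :+ k)) :+ (t :- (m :+ k))))
                refl (mass u) (mass v) total)))

    module Weights (ℓ : ℚ) (0<ℓ : 0ℚ < ℓ) (2≤ℓ² : 2ℚ ≤ ℓ * ℓ)
      (bound : half * half + 4ℚ ≤ (ℓ * ℓ - 2ℚ) * (ℓ * ℓ - 2ℚ)) where

      L a : ℚ
      L = ℓ * ℓ
      a = ½ * (L - half)

      -- Dropping the 4 in `bound` leaves a comparison of squares, and `L - 2ℚ` is non-negative.
      half≤L-2 : half ≤ L - 2ℚ
      half≤L-2 = square-cancel-≤ (≤⇒0≤ 2≤ℓ²) (ℚ.≤-trans (≤-by (ℚ.nonNegative⁻¹ 4ℚ) refl) bound)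

      1≤a : 1ℚ ≤ a
      1≤a = ≤-by (0≤* (ℚ.nonNegative⁻¹ ½) (≤⇒0≤ half≤L-2))
        (solve 2 (λ L h → con ½ :* (L :- h) := con 1ℚ :+ con ½ :* ((L :- con 2ℚ) :- h)) refl L half)

      half≤L : half ≤ L
      half≤L = ℚ.≤-trans half≤L-2 (≤-by (ℚ.nonNegative⁻¹ 2ℚ)
        (solve 1 (λ L → L := (L :- con 2ℚ) :+ con 2ℚ) refl L))

      -- F is a sum over subtrees, hence C u plus the F of the children of u is
      -- always L.  On the path F u = a + side u lies in [a , a + half], which is
      -- [a , L - a], so there F u (L - F u) ≥ a (L - a) ≥ L by bound.
      φ F C : Fin n → ℚ
      φ w = a * 𝟙 (w ≟ b) + off w - 𝟙 (w ≟ v) * mass v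
      F   = below φ
      C u = L - F u + φ u

      -- The three summands of `φ` contribute `a` to the ancestors of `b`, then `mass u`, then
      -- `- mass v` to the ancestors of `v`; the last two make up `side u`.
      F-value : ∀ u → F u ≡ a * anc u b + side u
      F-value u = begin
        ∑.sum (λ w → anc u w * φ w)
          ≡⟨ ∑.sum-cong-≗ (λ w → solve 6 (λ A a p q r m →
               A :* (a :* p :+ q :- r :* m) := p :* (A :* a) :+ (A :* q :+ r :* (A :* (con 0ℚ :- m))))
               refl (anc u w) a (𝟙 (w ≟ b)) (off w) (𝟙 (w ≟ v)) (mass v)) ⟩
        ∑.sum (λ w → f₁ w + (f₂ w + f₃ w))
          ≡⟨ ∑.∑-distrib-+ f₁ (λ w → f₂ w + f₃ w) ⟩
        ∑.sum f₁ + ∑.sum (λ w → f₂ w + f₃ w)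
          ≡⟨ cong (∑.sum f₁ +_) (∑.∑-distrib-+ f₂ f₃) ⟩
        ∑.sum f₁ + (mass u + ∑.sum f₃)
          ≡⟨ cong₂ (λ p q → p + (mass u + q)) (sum-𝟙≟ b (λ w → anc u w * a))
               (sum-𝟙≟ v (λ w → anc u w * (0ℚ - mass v))) ⟩
        anc u b * a + (mass u + anc u v * (0ℚ - mass v))
          ≡⟨ solve 5 (λ A a m B k → A :* a :+ (m :+ B :* (con 0ℚ :- k)) :=
               a :* A :+ (m :- B :* k)) refl (anc u b) a (mass u) (anc u v) (mass v) ⟩
        a * anc u b + side u ∎
        where
        open ≡-Reasoning
        f₁ f₂ f₃ : Fin n → ℚ
        f₁ w = 𝟙 (w ≟ b) * (anc u w * a)
        f₂ w = anc u w * off w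
        f₃ w = 𝟙 (w ≟ v) * (anc u w * (0ℚ - mass v))

      F-on : ∀ {u} → u ≼ b → F u ≡ a + side u
      F-on {u} u≼b = trans (F-value u) (cong (_+ side u)
        (trans (cong (a *_) (𝟙-true (u ≼? b) u≼b)) (ℚ.*-identityʳ a)))

      F-off : ∀ {u} → ¬ u ≼ b → F u ≡ side u
      F-off {u} u⋠b = trans (F-value u) (trans (cong (λ t → a * t + side u) (𝟙-false (u ≼? b) u⋠b))
        (solve 2 (λ a s → a :* con 0ℚ :+ s := s) refl a (side u)))

      φ-≢v : ∀ {u} → u ≢ v → φ u ≡ a * 𝟙 (u ≟ b) + off u
      φ-≢v {u} u≢v = trans (cong (λ t → a * 𝟙 (u ≟ b) + off u - t * mass v) (𝟙-false (u ≟ v) u≢v))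
        (solve 2 (λ p m → p :- con 0ℚ :* m := p) refl (a * 𝟙 (u ≟ b) + off u) (mass v))

      0≤φ : ∀ {u} → u ≢ v → 0ℚ ≤ φ u
      0≤φ {u} u≢v = subst (0ℚ ≤_) (sym (φ-≢v u≢v))
        (0≤+ (0≤* (ℚ.≤-trans 0≤1 1≤a) (0≤𝟙 (u ≟ b))) (0≤off u))

      φ-off : ∀ {u} → u ≢ v → ¬ u ≼ b → φ u ≡ 1ℚ
      φ-off {u} u≢v u⋠b = trans (φ-≢v u≢v) (trans
        (cong₂ (λ p q → a * p + (1ℚ - q)) (𝟙-false (u ≟ b) λ { refl → u⋠b here }) (𝟙-false (u ≼? b) u⋠b))
        (solve 1 (λ a → a :* con 0ℚ :+ (con 1ℚ :- con 0ℚ) := con 1ℚ) refl a))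

      -- The positivity that `weighted-AM-GM` asks for. It excludes `v`, where `side` is 0 and hence
      -- `F` is 0 if `v` lies off the path.
      1≤F : ∀ {u} → u ≢ v → 1ℚ ≤ F u
      1≤F {u} u≢v = case u ≼? b of λ where
        (yes u≼b) → subst (1ℚ ≤_) (sym (F-on u≼b))
            (ℚ.≤-trans 1≤a (≤-by (0≤side u) refl))
        (no u⋠b) → subst (1ℚ ≤_) (sym (F-off u⋠b)) (1≤side u≢v u⋠b)

      0<F : ∀ {u} → u ≢ v → 0ℚ < F u
      0<F u≢v = ℚ.<-≤-trans (ℚ.positive⁻¹ 1ℚ) (1≤F u≢v)

      0≤F : ∀ u → 0ℚ ≤ F u
      0≤F u = subst (0ℚ ≤_) (sym (F-value u))
        (0≤+ (0≤* (ℚ.≤-trans 0≤1 1≤a) (0≤𝟙 (u ≼? b))) (0≤side u))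

      L≤FC : ∀ {u} → u ≢ v → L ≤ F u * C u
      L≤FC {u} u≢v = case u ≼? b of λ where
        -- A quarter of `bound` says `L ≤ a * (L - a)`. Moving from `a` to `a + s` with
        -- `s = side u ≤ half` adds `s (half - s)`, and the summand `φ u` of `C u` adds `F u * φ u`;
        -- neither is negative.
        (yes u≼b) → ≤-by
            (0≤+ (0≤+ (0≤* (ℚ.nonNegative⁻¹ (½ * ½)) (≤⇒0≤ bound))
                      (0≤* (0≤side u) (≤⇒0≤ (side≤half u≢v))))
                 (0≤* (0≤+ (ℚ.≤-trans 0≤1 1≤a) (0≤side u)) (0≤φ u≢v)))
            (trans (cong (λ f → f * (L - f + φ u)) (F-on u≼b))
              (solve 4 (λ L h s p →
                (con ½ :* (L :- h) :+ s) :* (L :- (con ½ :* (L :- h) :+ s) :+ p) :=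
                L :+ (con (½ * ½) :* ((L :- con 2ℚ) :* (L :- con 2ℚ) :- (h :* h :+ con 4ℚ))
                  :+ s :* (h :- s) :+ (con ½ :* (L :- h) :+ s) :* p))
                refl L half (side u) (φ u)))
        -- Here `φ u` is 1, so the excess over `L` factors as `(s - 1) (L - s)`, and
        -- `1 ≤ s ≤ half ≤ L`.
        (no u⋠b) → ≤-by
            (0≤* (≤⇒0≤ (1≤side u≢v u⋠b)) (≤⇒0≤ (ℚ.≤-trans (side≤half u≢v) half≤L)))
            (trans (cong₂ (λ f p → f * (L - f + p)) (F-off u⋠b) (φ-off u≢v u⋠b))
              (solve 2 (λ L s → s :* (L :- s :+ con 1ℚ) := L :+ (s :- con 1ℚ) :* (L :- s))
                refl L (side u)))

      module Bound (x : Fin n → ℚ) (xv≡0 : x v ≡ 0ℚ) where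

        edge : ∀ c u → ℓ * (x c * x u + x c * x u) ≤ C c * (x c * x c) + F c * (x u * x u)
        edge c u = case c ≟ v of λ where
          (no c≢v) → weighted-AM-GM {ℓ} {C c} {F c} (0<F c≢v) (L≤FC c≢v) (x c) (x u)
          (yes c≡v) → ≤-by (0≤* (0≤F c) (0≤² (x u)))
            (subst (λ y → C c * (y * y) + F c * (x u * x u) ≡
                ℓ * (y * x u + y * x u) + F c * (x u * x u))
              (sym (trans (cong x c≡v) xv≡0))
              (solve 4 (λ ℓ C f y → C :* (con 0ℚ :* con 0ℚ) :+ f :=
                ℓ :* (con 0ℚ :* y :+ con 0ℚ :* y) :+ f) refl ℓ (C c) (F c * (x u * x u)) (x u)))

        -- The case `y = 0` of `weighted-AM-GM`. It matters at the root, whose `C` term belongs to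
        -- no edge: in `upper` that term may be added because it is not negative.
        0≤Cx² : ∀ c → 0ℚ ≤ C c * (x c * x c)
        0≤Cx² c = case c ≟ v of λ where
          (no c≢v) → subst₂ _≤_
            (solve 2 (λ ℓ x → ℓ :* (x :* con 0ℚ :+ x :* con 0ℚ) := con 0ℚ) refl ℓ (x c))
            (solve 2 (λ p F → p :+ F :* (con 0ℚ :* con 0ℚ) := p) refl (C c * (x c * x c)) (F c))
            (weighted-AM-GM {ℓ} {C c} {F c} (0<F c≢v) (L≤FC c≢v) (x c) 0ℚ)
          (yes c≡v) → subst (λ y → 0ℚ ≤ C c * (y * y)) (sym (trans (cong x c≡v) xv≡0))
            (ℚ.≤-reflexive (solve 1 (λ C → con 0ℚ := C :* (con 0ℚ :* con 0ℚ)) refl (C c)))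

        -- Each edge is counted once, from child to parent, so `form + form` is the quadratic form
        -- of the adjacency matrix.
        form norm : ℚ
        form = ∑.sum (λ c → ∑.sum (λ u → child c u * (x c * x u)))
        norm = ∑.sum (λ u → x u * x u)

        ℓ-form : ℓ * (form + form) ≡ ∑.sum (λ c → ∑.sum (λ u → child c u * (ℓ * (x c * x u + x c * x u))))
        ℓ-form = begin
          ℓ * (form + form)
            ≡⟨ solve 2 (λ ℓ f → ℓ :* (f :+ f) := (ℓ :+ ℓ) :* f) refl ℓ form ⟩
          (ℓ + ℓ) * form
            ≡⟨ ∑.*-distribˡ-sum (ℓ + ℓ) (λ c → ∑.sum (λ u → child c u * (x c * x u))) ⟩
          ∑.sum (λ c → (ℓ + ℓ) * ∑.sum (λ u → child c u * (x c * x u)))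
            ≡⟨ ∑.sum-cong-≗ (λ c → trans (∑.*-distribˡ-sum (ℓ + ℓ) (λ u → child c u * (x c * x u)))
                 (∑.sum-cong-≗ λ u → solve 3 (λ ℓ k p → (ℓ :+ ℓ) :* (k :* p) := k :* (ℓ :* (p :+ p)))
                   refl ℓ (child c u) (x c * x u))) ⟩
          ∑.sum (λ c → ∑.sum (λ u → child c u * (ℓ * (x c * x u + x c * x u)))) ∎
          where open ≡-Reasoning

        -- At `u` the edge to the parent contributes at most `C u`, and the edges to the children
        -- contribute the sum of their `F`, which is `F u - φ u` by `below-children`. Together this
        -- is `L`.
        upper : ∑.sum (λ c → ∑.sum (λ u → child c u * (C c * (x c * x c) + F c * (x u * x u)))) ≤ L * norm
        upper = begin
          ∑.sum (λ c → ∑.sum (λ u → child c u * (C c * (x c * x c) + F c * (x u * x u))))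
            ≡⟨ ∑.sum-cong-≗ (λ c → trans
                 (∑.sum-cong-≗ λ u → ℚ.*-distribˡ-+ (child c u) (C c * (x c * x c)) (F c * (x u * x u)))
                 (∑.∑-distrib-+ (λ u → child c u * (C c * (x c * x c))) (λ u → child c u * (F c * (x u * x u))))) ⟩
          ∑.sum (λ c → ∑.sum (λ u → child c u * (C c * (x c * x c))) + ∑.sum (λ u → child c u * (F c * (x u * x u))))
            ≡⟨ ∑.∑-distrib-+ (λ c → ∑.sum (λ u → child c u * (C c * (x c * x c))))
                 (λ c → ∑.sum (λ u → child c u * (F c * (x u * x u)))) ⟩
          ∑.sum (λ c → ∑.sum (λ u → child c u * (C c * (x c * x c)))) + ∑.sum (λ c → ∑.sum (λ u → child c u * (F c * (x u * x u))))
            ≤⟨ ℚ.+-monoˡ-≤ (∑.sum (λ c → ∑.sum (λ u → child c u * (F c * (x u * x u))))) (sum-mono-≤ own) ⟩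
          ∑.sum (λ c → C c * (x c * x c)) + ∑.sum (λ c → ∑.sum (λ u → child c u * (F c * (x u * x u))))
            ≡⟨ cong (∑.sum (λ c → C c * (x c * x c)) +_)
                 (trans (∑.∑-comm (λ c u → child c u * (F c * (x u * x u)))) (∑.sum-cong-≗ children)) ⟩
          ∑.sum (λ c → C c * (x c * x c)) + ∑.sum (λ u → (F u - φ u) * (x u * x u))
            ≡⟨ sym (∑.∑-distrib-+ (λ c → C c * (x c * x c)) (λ u → (F u - φ u) * (x u * x u))) ⟩
          ∑.sum (λ u → C u * (x u * x u) + (F u - φ u) * (x u * x u))
            ≡⟨ ∑.sum-cong-≗ (λ u → solve 4 (λ L F p s →
                 (L :- F :+ p) :* s :+ (F :- p) :* s := L :* s) refl L (F u) (φ u) (x u * x u)) ⟩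
          ∑.sum (λ u → L * (x u * x u))
            ≡⟨ sym (∑.*-distribˡ-sum L (λ u → x u * x u)) ⟩
          L * norm ∎
          where
          open ℚ.≤-Reasoning
          own : ∀ c → ∑.sum (λ u → child c u * (C c * (x c * x c))) ≤ C c * (x c * x c)
          own c = subst₂ _≤_ (∑.*-distribʳ-sum (C c * (x c * x c)) (child c))
            (ℚ.*-identityˡ (C c * (x c * x c)))
            (ℚ.*-monoʳ-≤-nonNeg (C c * (x c * x c)) {{ℚ.nonNegative (0≤Cx² c)}} (sum-child≤1 c))
          children : ∀ u → ∑.sum (λ c → child c u * (F c * (x u * x u))) ≡ (F u - φ u) * (x u * x u)
          children u = trans
            (trans (∑.sum-cong-≗ λ c → sym (ℚ.*-assoc (child c u) (F c) (x u * x u)))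
                   (sym (∑.*-distribʳ-sum (x u * x u) (λ c → child c u * F c))))
            (cong (_* (x u * x u)) (trans
              (solve 2 (λ p s → s := (p :+ s) :- p) refl (φ u) (∑.sum (λ c → child c u * F c)))
              (cong (_- φ u) (sym (below-children φ u)))))

        form-bound : form + form ≤ ℓ * norm
        form-bound = ℚ.*-cancelˡ-≤-pos ℓ {{ℚ.positive 0<ℓ}} (begin
          ℓ * (form + form) ≡⟨ ℓ-form ⟩
          ∑.sum (λ c → ∑.sum (λ u → child c u * (ℓ * (x c * x u + x c * x u))))
            ≤⟨ sum-mono-≤ (λ c → sum-mono-≤ λ u → ℚ.*-monoˡ-≤-nonNeg (child c u)
                 {{ℚ.nonNegative (0≤𝟙 (isChild? c u))}} (edge c u)) ⟩
          ∑.sum (λ c → ∑.sum (λ u → child c u * (C c * (x c * x c) + F c * (x u * x u)))) ≤⟨ upper ⟩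
          ℓ * ℓ * norm ≡⟨ ℚ.*-assoc ℓ ℓ norm ⟩
          ℓ * (ℓ * norm) ∎)
          where open ℚ.≤-Reasoning

-- Rooting a tree

least : ∀ {P : ℕ → Set} → (∀ k → Dec (P k)) → ∀ k → P k →
  ∃[ l ] P l × (∀ m → P m → l ℕ.≤ m)
least P? zero    p = zero , p , λ _ _ → z≤n
least P? (suc k) p = case P? zero of λ where
  (yes p₀) → zero , p₀ , λ _ _ → z≤n
  (no ¬p₀) → let l , pl , min = least (P? ∘ suc) k p in suc l , pl , λ where
    zero    p₀ → contradiction p₀ ¬p₀
    (suc m) pm → s≤s (min m pm)

module _ {n} {G : Graph n} where

  walk? : ∀ u v k → Dec (Walk G u v k)
  walk? u v zero = map′ (λ { refl → [] }) (λ { [] → refl }) (u ≟ v)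
  walk? u v (suc k) = map′ (λ (_ , e , w) → e ∷ w) (λ { (e ∷ w) → _ , e , w })
    (Fin.any? λ x → (adj G u x Bool.≟ true) ×-dec walk? x v k)

  shortest : ∀ {u v k} → Walk G u v k → ∃ (IsDistance G u v)
  shortest {u} {v} {k} w = least (walk? u v) k w

  _++_ : ∀ {u v w k l} → Walk G u v k → Walk G v w l → Walk G u w (k ℕ.+ l)
  []      ++ q = q
  (e ∷ p) ++ q = e ∷ (p ++ q)

  reverse : ∀ {u v k} → Walk G u v k → ∃ (Walk G v u)
  reverse []      = 0 , []
  reverse (_∷_ {u} {v} e p) =
    _ , proj₂ (reverse p) ++ (trans (symmetric G v u) e ∷ [])

  vertex : ∀ {u v k} → Walk G u v k → Fin (suc k) → Fin n
  vertex {u} w       zero    = u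
  vertex     (_ ∷ w) (suc i) = vertex w i

  vertex-last : ∀ {u v k} (w : Walk G u v k) → vertex w (fromℕ k) ≡ v
  vertex-last []      = refl
  vertex-last (_ ∷ w) = vertex-last w

  vertex-step : ∀ {u v k} (w : Walk G u v k) i → adj G (vertex w (inject₁ i)) (vertex w (suc i)) ≡ true
  vertex-step (e ∷ w) zero    = e
  vertex-step (_ ∷ w) (suc i) = vertex-step w i

  suffix : ∀ {u v k} (w : Walk G u v k) i → ∃[ l ] l ℕ.≤ k × Walk G (vertex w i) v l
  suffix w       zero    = _ , ℕ.≤-refl , w
  suffix (_ ∷ w) (suc i) = let l , l≤k , q = suffix w i in l , ℕ.m≤n⇒m≤1+n l≤k , q

  -- A return to the first vertex could be cut out, and `suffix` would be a strictly shorter walk.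
  -- The tail of a shortest walk is again shortest, which covers the later repetitions.
  shortest-injective : ∀ {u v k} (w : Walk G u v k) → (∀ l → Walk G u v l → k ℕ.≤ l) →
    ∀ i j → vertex w i ≡ vertex w j → i ≡ j
  shortest-injective w       min zero    zero    _  = refl
  shortest-injective (e ∷ w) min zero    (suc j) eq =
    let l , l≤k , q = suffix w j in
    contradiction (ℕ.≤-trans (min l (subst (λ x → Walk G x _ l) (sym eq) q)) l≤k) ℕ.1+n≰n
  shortest-injective (e ∷ w) min (suc i) zero    eq =
    let l , l≤k , q = suffix w i in
    contradiction (ℕ.≤-trans (min l (subst (λ x → Walk G x _ l) eq q)) l≤k) ℕ.1+n≰n
  shortest-injective (e ∷ w) min (suc i) (suc j) eq =
    cong suc (shortest-injective w (λ l q → ℕ.s≤s⁻¹ (min (suc l) (e ∷ q))) i j eq)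

module _ {n} (G : Graph n) (a b : Fin n) where

  is-ab : Fin n → Fin n → Bool
  is-ab x y = (does (x ≟ a) ∧ does (y ≟ b)) ∨ (does (x ≟ b) ∧ does (y ≟ a))

  delete : Graph n
  delete = record
    { adj         = λ x y → adj G x y ∧ not (is-ab x y)
    ; symmetric   = λ x y → cong₂ (λ p q → p ∧ not q) (symmetric G x y)
        (trans (Bool.∨-comm (does (x ≟ a) ∧ does (y ≟ b)) _)
          (cong₂ _∨_ (Bool.∧-comm (does (x ≟ b)) _) (Bool.∧-comm (does (x ≟ a)) _)))
    ; irreflexive = λ x → cong (_∧ not (is-ab x x)) (irreflexive G x)
    }

  deleted-ab : adj delete a b ≡ false
  deleted-ab = trans
    (cong₂ (λ p q → adj G a b ∧ not ((p ∧ q) ∨ (does (a ≟ b) ∧ does (b ≟ a))))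
      (dec-true (a ≟ a) refl) (dec-true (b ≟ b) refl))
    (Bool.∧-zeroʳ (adj G a b))

  kept : ∀ {x y} → ¬ (x ≡ a × y ≡ b) → ¬ (x ≡ b × y ≡ a) → adj G x y ≡ true → adj delete x y ≡ true
  kept {x} {y} ≢ab ≢ba e = cong₂ (λ p q → p ∧ not q) e
    (cong₂ _∨_ (dec-false ((x ≟ a) ×-dec (y ≟ b)) ≢ab) (dec-false ((x ≟ b) ×-dec (y ≟ a)) ≢ba))

  -- A shortest walk round the deleted edge repeats no vertex.
  detour⇒cycle : adj G a b ≡ true → ∃ (Walk delete a b) → Cycle G
  detour⇒cycle ab (_ , w) with shortest w
  ... | zero , [] , _ = contradiction (trans (sym ab) (irreflexive G a)) λ ()
  ... | suc zero , e ∷ [] , _ = contradiction (trans (sym e) deleted-ab) λ ()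
  ... | suc (suc k) , p , min = record
    { c        = vertex p
    ; distinct = λ {i} {j} → shortest-injective p min i j
    ; step     = λ i → Bool.∧-conicalˡ _ _ (vertex-step p i)
    ; close    = trans (cong (λ x → adj G x a) (vertex-last p)) (trans (symmetric G b a) ab)
    }

module TreeRooting {n} (G : Graph n) (connected : Connected G) (acyclic : ¬ Cycle G) (r : Fin n) where

  distance : ∀ w → ∃ (IsDistance G w r)
  distance w = shortest (proj₂ (proj₂ connected w r))

  next : ∀ {u k} → Walk G u r k → Fin n
  next {u} []       = u
  next (_∷_ {v = v} _ _) = v

  δ : Fin n → ℕ
  δ w = proj₁ (distance w)

  parent : Fin n → Fin n
  parent w = next (proj₁ (proj₂ (distance w)))

  parent-adj : ∀ {w} → w ≢ r → adj G w (parent w) ≡ true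
  parent-adj {w} w≢r with distance w
  ... | zero  , [] , _    = contradiction refl w≢r
  ... | suc _ , e ∷ _ , _ = e

  -- Removing the first edge of a shortest walk leaves a walk from the parent; conversely,
  -- prepending that edge to a shortest walk from the parent bounds `δ w`.
  δ-parent : ∀ {w} → w ≢ r → suc (δ (parent w)) ≡ δ w
  δ-parent {w} w≢r with distance w
  ... | zero  , [] , _ = contradiction refl w≢r
  ... | suc k , _∷_ {v = v} e p , min = ℕ.≤-antisym
    (s≤s (proj₂ (proj₂ (distance v)) k p))
    (min (suc (δ v)) (e ∷ proj₁ (proj₂ (distance v))))

  distance-unique : ∀ {w k} → IsDistance G w r k → δ w ≡ k
  distance-unique {w} {k} (p , min) = ℕ.≤-antisym
    (proj₂ (proj₂ (distance w)) k p) (min (δ w) (proj₁ (proj₂ (distance w))))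

  tree : RootedTree n
  tree = record
    { root       = r
    ; par        = parent
    ; depth      = δ
    ; depth-root = distance-unique ([] , λ _ _ → z≤n)
    ; depth-par  = δ-parent
    }

  open Ancestors tree

  -- If neither end were the parent of the other, every edge from a vertex to its parent would
  -- survive the deletion of the edge `u w`. Both ends would still reach `r`, and the detour through
  -- `r` would yield a cycle.
  edge⇒child : ∀ {u w} → adj G u w ≡ true → IsChild u w ⊎ IsChild w u
  edge⇒child {u} {w} uw = case isChild? u w of λ where
    (yes ch) → inj₁ ch
    (no ¬uw) → case isChild? w u of λ where
      (yes ch) → inj₂ ch
      (no ¬wu) →
        let up-edge : ∀ {x} → x ≢ r → adj (delete G u w) x (parent x) ≡ true
            up-edge x≢r = kept G u w
              (λ (x≡u , p≡w) → ¬uw ((x≢r ∘ trans x≡u) , trans (cong parent (sym x≡u)) p≡w))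
              (λ (x≡w , p≡u) → ¬wu ((x≢r ∘ trans x≡w) , trans (cong parent (sym x≡w)) p≡u))
              (parent-adj x≢r)
            to-root = climb {λ x → ∃ (Walk (delete G u w) x r)} (0 , [])
              (λ x≢r (_ , p) → _ , up-edge x≢r ∷ p)
        in contradiction
          (detour⇒cycle G u w uw (_ , proj₂ (to-root u) ++ proj₂ (reverse (proj₂ (to-root w)))))
          acyclic

  child⇒edge : ∀ {c u} → IsChild c u → adj G c u ≡ true
  child⇒edge (c≢r , refl) = parent-adj c≢r

  open Data.Rational using (_+_; _-_; _*_)

  -- The two orientations of an edge exclude each other, because a child is never an ancestor of its
  -- parent.
  adjacency-split : ∀ u w → (if adj G u w then 1ℚ else 0ℚ) ≡ child u w + child w u
  adjacency-split u w = case adj G u w Bool.≟ true of λ where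
    (yes uw) → trans (cong (if_then 1ℚ else 0ℚ) uw) (case edge⇒child uw of λ where
      (inj₁ ch) → sym (cong₂ _+_ (𝟙-true (isChild? u w) ch)
        (𝟙-false (isChild? w u) λ ch′ → child-⋠ ch (child-≼ ch′)))
      (inj₂ ch) → sym (cong₂ _+_
        (𝟙-false (isChild? u w) λ ch′ → child-⋠ ch (child-≼ ch′)) (𝟙-true (isChild? w u) ch)))
    (no ¬uw) → trans (cong (if_then 1ℚ else 0ℚ) (Bool.¬-not ¬uw)) (sym (cong₂ _+_
      (𝟙-false (isChild? u w) (¬uw ∘ child⇒edge))
      (𝟙-false (isChild? w u) (¬uw ∘ trans (symmetric G u w) ∘ child⇒edge))))

-- Counting the vertices on and off the path.

ι : ℕ → ℚ
ι k = ℤ.+ k ℚ./ 1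

module _ where
  open Data.Rational using (_+_; _-_; _*_)

  toℚᵘ-/ : ∀ i m → ℚ.toℚᵘ (i ℚ./ suc m) ℚᵘ.≃ ℚᵘ.mkℚᵘ i m
  toℚᵘ-/ i m = ℚ.toℚᵘ-fromℚᵘ (ℚᵘ.mkℚᵘ i m)

  -- `_/_` reduces by a gcd, so the claim is moved to unnormalised rationals, where equality is a
  -- cross-multiplied identity of integers. `half-difference` proceeds likewise.
  ι-suc : ∀ k → ι (suc k) ≡ 1ℚ + ι k
  ι-suc k = ℚ.toℚᵘ-injective (ℚᵘ.≃-trans (toℚᵘ-/ (ℤ.+ suc k) 0) (ℚᵘ.≃-trans
    (ℚᵘ.*≡* (solve′ 1 (λ k → (con′ (ℤ.+ 1) :+′ k) :*′ con′ (ℤ.+ 1) :=′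
      ((con′ (ℤ.+ 1) :*′ con′ (ℤ.+ 1)) :+′ (k :*′ con′ (ℤ.+ 1))) :*′ con′ (ℤ.+ 1)) refl (ℤ.+ k)))
    (ℚᵘ.≃-sym (ℚᵘ.≃-trans (ℚ.toℚᵘ-homo-+ 1ℚ (ι k))
      (ℚᵘ.+-congʳ (ℚ.toℚᵘ 1ℚ) (toℚᵘ-/ (ℤ.+ k) 0))))))
    where
    open ℤ.+-*-Solver renaming
      (solve to solve′; con to con′; _:+_ to _:+′_; _:*_ to _:*′_; _:=_ to _:=′_)

  half-difference : ∀ n d → (ℤ.+ n ℤ.- ℤ.+ d) ℚ./ 2 ≡ ½ * (ι n - ι d)
  half-difference n d = ℚ.toℚᵘ-injective (ℚᵘ.≃-trans (toℚᵘ-/ (ℤ.+ n ℤ.- ℤ.+ d) 1) (ℚᵘ.≃-trans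
    (ℚᵘ.*≡* (solve′ 2 (λ n d → (n :-′ d) :*′ con′ (ℤ.+ 2) :=′
      (con′ (ℤ.+ 1) :*′ (n :*′ con′ (ℤ.+ 1) :+′ (:-″ d) :*′ con′ (ℤ.+ 1))) :*′ con′ (ℤ.+ 2)) refl (ℤ.+ n) (ℤ.+ d)))
    (ℚᵘ.≃-sym (ℚᵘ.≃-trans (ℚ.toℚᵘ-homo-* ½ (ι n - ι d)) (ℚᵘ.*-congˡ {ℚ.toℚᵘ ½}
      (ℚᵘ.≃-trans (ℚ.toℚᵘ-homo-+ (ι n) (ℚ.- ι d)) (ℚᵘ.+-cong (toℚᵘ-/ (ℤ.+ n) 0)
        (ℚᵘ.≃-trans (ℚ.toℚᵘ-homo‿- (ι d)) (ℚᵘ.-‿cong (toℚᵘ-/ (ℤ.+ d) 0))))))))))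
    where
    open ℤ.+-*-Solver renaming
      (solve to solve′; con to con′; _:+_ to _:+′_; _:*_ to _:*′_; _:=_ to _:=′_; _:-_ to _:-′_; :-_ to :-″_)

  sum-1 : ∀ n → ∑.sum {n} (λ _ → 1ℚ) ≡ ι n
  sum-1 zero    = refl
  sum-1 (suc n) = trans (cong (1ℚ +_) (sum-1 n)) (sym (ι-suc n))

module _ {n} (T : RootedTree n) where
  open RootedTree T
  open Ancestors T
  open Data.Rational using (_+_; _-_; _*_)

  -- Each step down from the root adds one vertex to the chain of ancestors. A vertex counts among
  -- its own ancestors, hence the `suc`.
  sum-anc : ∀ w → ∑.sum (λ u → anc u w) ≡ ι (suc (depth w))
  sum-anc = climb base step
    where
    base : ∑.sum (λ u → anc u root) ≡ ι (suc (depth root))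
    base = trans (∑.sum-cong-≗ only-root) (trans (sum-𝟙≟-1 root) (cong (ι ∘ suc) (sym depth-root)))
      where
      only-root : ∀ u → anc u root ≡ 𝟙 (u ≟ root)
      only-root u = case u ≟ root of λ where
        (yes u≡) → trans (𝟙-true (u ≼? root) (subst (u ≼_) u≡ here)) (sym (𝟙-true (u ≟ root) u≡))
        (no u≢)  → trans (𝟙-false (u ≼? root) λ u≼ → proj₁ (≼-par u≼ u≢) refl) (sym (𝟙-false (u ≟ root) u≢))
    step : ∀ {w} → w ≢ root → ∑.sum (λ u → anc u (par w)) ≡ ι (suc (depth (par w))) →
      ∑.sum (λ u → anc u w) ≡ ι (suc (depth w))
    step {w} w≢ ih = begin
      ∑.sum (λ u → anc u w)                       ≡⟨ ∑.sum-cong-≗ (λ u → anc-par u w≢) ⟩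
      ∑.sum (λ u → 𝟙 (u ≟ w) + anc u (par w))     ≡⟨ ∑.∑-distrib-+ (λ u → 𝟙 (u ≟ w)) (λ u → anc u (par w)) ⟩
      ∑.sum (λ u → 𝟙 (u ≟ w)) + ∑.sum (λ u → anc u (par w)) ≡⟨ cong₂ _+_ (sum-𝟙≟-1 w) ih ⟩
      1ℚ + ι (suc (depth (par w)))                ≡⟨ sym (ι-suc (suc (depth (par w)))) ⟩
      ι (suc (suc (depth (par w))))               ≡⟨ cong (ι ∘ suc) (depth-par w≢) ⟩
      ι (suc (depth w))                           ∎
      where open ≡-Reasoning

  sum-non-ancestors : ∀ b → ∑.sum (λ w → 1ℚ - anc w b) ≡ ι n - ι (suc (depth b))
  sum-non-ancestors b = begin
    s                                ≡⟨ solve 2 (λ s t → s := (s :+ t) :- t) refl s t ⟩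
    (s + t) - t                      ≡⟨ cong₂ _-_ s+t (sum-anc b) ⟩
    ι n - ι (suc (depth b))          ∎
    where
    open ≡-Reasoning
    s = ∑.sum (λ w → 1ℚ - anc w b)
    t = ∑.sum (λ w → anc w b)
    s+t : s + t ≡ ι n
    s+t = trans (sym (∑.∑-distrib-+ (λ w → 1ℚ - anc w b) (λ w → anc w b)))
      (trans (∑.sum-cong-≗ λ w → solve 1 (λ p → (con 1ℚ :- p) :+ p := con 1ℚ) refl (anc w b)) (sum-1 n))

-- Real numbers

open Defs using (_+_; _*_; _<_; _≤_; sum)

Eventually : (ℕ → Set) → Set
Eventually P = ∃[ N ] ∀ k → N ℕ.≤ k → P k

always : ∀ {P : ℕ → Set} → (∀ k → P k) → Eventually P
always p = 0 , λ k _ → p k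

eventually₂ : ∀ {P Q R : ℕ → Set} → (∀ k → P k → Q k → R k) →
  Eventually P → Eventually Q → Eventually R
eventually₂ f (M , p) (N , q) = M ⊔ N , λ k k≥ →
  f k (p k (ℕ.m⊔n≤o⇒m≤o M N k≥)) (q k (ℕ.m⊔n≤o⇒n≤o M N k≥))

eventually₁ : ∀ {P Q : ℕ → Set} → (∀ k → P k → Q k) → Eventually P → Eventually Q
eventually₁ f (N , p) = N , λ k k≥ → f k (p k k≥)

p≤∣p∣ : ∀ p → p ℚ.≤ ℚ.∣ p ∣
p≤∣p∣ p with ℚ.≤-total 0ℚ p
... | inj₁ 0≤p = ℚ.≤-reflexive (sym (ℚ.0≤p⇒∣p∣≡p 0≤p))
... | inj₂ p≤0 = ℚ.≤-trans p≤0 (ℚ.0≤∣p∣ p)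

∣-∣<⇒< : ∀ p q {ε} → ℚ.∣ p ℚ.- q ∣ ℚ.< ε → p ℚ.< q ℚ.+ ε
∣-∣<⇒< p q {ε} h = <-by (<⇒0< (ℚ.≤-<-trans (p≤∣p∣ (p ℚ.- q)) h))
  (solve 3 (λ p q e → q :+ e := p :+ (e :- (p :- q))) refl p q ε)

∣-∣-comm : ∀ p q → ℚ.∣ p ℚ.- q ∣ ≡ ℚ.∣ q ℚ.- p ∣
∣-∣-comm p q = trans (cong ℚ.∣_∣ (solve 2 (λ p q → p :- q := con 0ℚ :- (q :- p)) refl p q))
  (trans (cong ℚ.∣_∣ (ℚ.+-identityˡ (ℚ.- (q ℚ.- p)))) (ℚ.∣-p∣≡∣p∣ (q ℚ.- p)))

∣-∣<⇒> : ∀ p q {ε} → ℚ.∣ p ℚ.- q ∣ ℚ.< ε → q ℚ.< p ℚ.+ ε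
∣-∣<⇒> p q h = ∣-∣<⇒< q p (subst (ℚ._< _) (∣-∣-comm p q) h)

<⇒∣-∣< : ∀ p q {ε} → p ℚ.< q ℚ.+ ε → q ℚ.< p ℚ.+ ε → ℚ.∣ p ℚ.- q ∣ ℚ.< ε
<⇒∣-∣< p q {ε} p<q+ε q<p+ε with ℚ.∣p∣≡p∨∣p∣≡-p (p ℚ.- q)
... | inj₁ eq = subst (ℚ._< ε) (sym eq) (<-by (<⇒0< p<q+ε)
  (solve 3 (λ p q e → e := (p :- q) :+ ((q :+ e) :- p)) refl p q ε))
... | inj₂ eq = subst (ℚ._< ε) (sym eq) (<-by (<⇒0< q<p+ε)
  (solve 3 (λ p q e → e := (:- (p :- q)) :+ ((p :+ e) :- q)) refl p q ε))
  where open +-*-Solver using (:-_)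

≃-pointwise : ∀ {x y} → (∀ k → seq x k ≡ seq y k) → x ≃ y
≃-pointwise {x} {y} eq ε 0<ε = always λ k →
  subst (λ p → ℚ.∣ p ∣ ℚ.< ε) (sym (trans (cong (ℚ._- seq y k) (eq k)) (ℚ.+-inverseʳ (seq y k)))) 0<ε

≃-sym : ∀ {x y} → x ≃ y → y ≃ x
≃-sym {x} {y} x≃y ε 0<ε = eventually₁
  (λ k → subst (ℚ._< ε) (∣-∣-comm (seq x k) (seq y k))) (x≃y ε 0<ε)

∣+∣<½+½ : ∀ {p q ε} → ℚ.∣ p ∣ ℚ.< ½ ℚ.* ε → ℚ.∣ q ∣ ℚ.< ½ ℚ.* ε → ℚ.∣ p ℚ.+ q ∣ ℚ.< ε
∣+∣<½+½ {p} {q} {ε} hp hq = subst (ℚ.∣ p ℚ.+ q ∣ ℚ.<_) (halves ε)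
  (ℚ.≤-<-trans (ℚ.∣p+q∣≤∣p∣+∣q∣ p q) (ℚ.+-mono-< hp hq))

≃-trans : ∀ {x y z} → x ≃ y → y ≃ z → x ≃ z
≃-trans {x} {y} {z} x≃y y≃z ε 0<ε = eventually₂
  (λ k p q → subst (λ t → ℚ.∣ t ∣ ℚ.< ε)
    (solve 3 (λ x y z → (x :- y) :+ (y :- z) := x :- z) refl (seq x k) (seq y k) (seq z k))
    (∣+∣<½+½ p q))
  (x≃y (½ ℚ.* ε) (half-pos ε 0<ε)) (y≃z (½ ℚ.* ε) (half-pos ε 0<ε))

+-cong : ∀ {x x′ y y′} → x ≃ x′ → y ≃ y′ → x + y ≃ x′ + y′
+-cong {x} {x′} {y} {y′} x≃ y≃ ε 0<ε = eventually₂
  (λ k p q → subst (λ t → ℚ.∣ t ∣ ℚ.< ε)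
    (solve 4 (λ x x′ y y′ → (x :- x′) :+ (y :- y′) := (x :+ y) :- (x′ :+ y′)) refl
      (seq x k) (seq x′ k) (seq y k) (seq y′ k))
    (∣+∣<½+½ p q))
  (x≃ (½ ℚ.* ε) (half-pos ε 0<ε)) (y≃ (½ ℚ.* ε) (half-pos ε 0<ε))

quotient : ∀ {B ε} → 0ℚ ℚ.< B → 0ℚ ℚ.< ε → ∃[ δ ] 0ℚ ℚ.< δ × δ ℚ.* B ≡ ε
quotient {B} {ε} 0<B 0<ε = ε ℚ.* ℚ.1/ B
  , 0<* 0<ε (ℚ.positive⁻¹ (ℚ.1/ B) {{ℚ.1/pos⇒pos B}})
  , trans (ℚ.*-assoc ε (ℚ.1/ B) B) (trans (cong (ε ℚ.*_) (ℚ.*-inverseˡ B)) (ℚ.*-identityʳ ε))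
  where
  instance
    B-pos : ℚ.Positive B
    B-pos = ℚ.positive 0<B
    B-nonZero : ℚ.NonZero B
    B-nonZero = ℚ.pos⇒nonZero B

*-congˡ : ∀ x {y y′} → y ≃ y′ → x * y ≃ x * y′
*-congˡ x {y} {y′} y≃y′ ε 0<ε =
  let B , 0<B , x<B = bounded (seq x) (cauchy x)
      δ , 0<δ , δB≡ε = quotient 0<B 0<ε
  in eventually₂ (λ k xk<B yk → subst₂ (λ p q → ℚ.∣ p ∣ ℚ.< q)
       (solve 3 (λ x y z → x :* (y :- z) := x :* y :- x :* z) refl (seq x k) (seq y k) (seq y′ k))
       (trans (ℚ.*-comm B δ) δB≡ε)
       (∣∣*∣∣-bound (seq x k) (seq y k ℚ.- seq y′ k) B δ 0<B xk<B yk))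
     x<B (y≃y′ δ 0<δ)

*-comm : ∀ x y → x * y ≃ y * x
*-comm x y = ≃-pointwise {x * y} {y * x} λ k → ℚ.*-comm (seq x k) (seq y k)

*-congʳ : ∀ {x x′} y → x ≃ x′ → x * y ≃ x′ * y
*-congʳ {x} {x′} y x≃x′ = ≃-trans {x * y} {y * x} {x′ * y} (*-comm x y)
  (≃-trans {y * x} {y * x′} {x′ * y} (*-congˡ y {x} {x′} x≃x′) (*-comm y x′))

sum-cong : ∀ {n} {f g : Vector ℝ n} → (∀ i → f i ≃ g i) → sum f ≃ sum g
sum-cong {zero} f≃g = ≃-pointwise {0ℝ} {0ℝ} λ _ → refl
sum-cong {suc n} {f} {g} f≃g = +-cong {f zero} {g zero} {sum (f ∘ suc)} {sum (g ∘ suc)}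
  (f≃g zero) (sum-cong (f≃g ∘ suc))

seq-sum : ∀ {n} (f : Vector ℝ n) k → seq (sum f) k ≡ ∑.sum (λ i → seq (f i) k)
seq-sum {zero}  f k = refl
seq-sum {suc n} f k = cong (seq (f zero) k ℚ.+_) (seq-sum (f ∘ suc) k)

0<+ : ∀ {p q} → 0ℚ ℚ.< p → 0ℚ ℚ.≤ q → 0ℚ ℚ.< p ℚ.+ q
0<+ = ℚ.+-mono-<-≤

-- `x ≤ y` is only a negation, yet it gives eventual bounds: the rational comparison at one late
-- index `K` is decidable, and its failure would separate the two tails and prove `y < x`.
≤⇒eventually : ∀ {x y} → x ≤ y → ∀ ε → 0ℚ ℚ.< ε → Eventually (λ k → seq x k ℚ.< seq y k ℚ.+ ε)
≤⇒eventually {x} {y} x≤y ε 0<ε =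
  let M , cx = cauchy x η 0<η
      N , cy = cauchy y η 0<η
      K = M ⊔ N
      M≤K = ℕ.m≤m⊔n M N
      N≤K = ℕ.m≤n⊔m M N
      near-x = λ k K≤k → cx k K (ℕ.≤-trans M≤K K≤k) M≤K
      near-y = λ k K≤k → cy k K (ℕ.≤-trans N≤K K≤k) N≤K
  in case seq x K ℚ.≤? (seq y K ℚ.+ (η ℚ.+ η)) of λ where
    (yes xK≤) → K , λ k K≤k →
      <-by (0<+ (ℚ.+-mono-< (<⇒0< (∣-∣<⇒< (seq x k) (seq x K) (near-x k K≤k)))
                            (<⇒0< (∣-∣<⇒> (seq y k) (seq y K) (near-y k K≤k)))) (≤⇒0≤ xK≤))
        (solve 5 (λ e x y X Y → let h = con (½ ℚ.* ½) :* e in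
           y :+ e := x :+ (((X :+ h :- x) :+ (y :+ h :- Y)) :+ ((Y :+ (h :+ h)) :- X)))
         refl ε (seq x k) (seq y k) (seq x K) (seq y K))
    (no xK≰) → contradiction
      (seq x K ℚ.- (seq y K ℚ.+ (η ℚ.+ η)) , <⇒0< (ℚ.≰⇒> xK≰) , K , λ k K≤k →
        <-by (ℚ.+-mono-< (<⇒0< (∣-∣<⇒> (seq x k) (seq x K) (near-x k K≤k)))
                         (<⇒0< (∣-∣<⇒< (seq y k) (seq y K) (near-y k K≤k))))
          (solve 5 (λ h x y X Y → x := (y :+ (X :- (Y :+ (h :+ h)))) :+
             ((x :+ h :- X) :+ (Y :+ h :- y))) refl η (seq x k) (seq y k) (seq x K) (seq y K)))
      x≤y
  where
  -- A quarter of `ε`: two of them are allowed at `K`, and each sequence may move by one between `K`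
  -- and `k`.
  η : ℚ
  η = (½ ℚ.* ½) ℚ.* ε
  0<η : 0ℚ ℚ.< η
  0<η = 0<* (ℚ.positive⁻¹ (½ ℚ.* ½)) 0<ε

≤-<-transℚ : ∀ {x q y} → x ≤ fromℚ q → fromℚ q < y → x < y
≤-<-transℚ {x} {q} {y} x≤q (ε , 0<ε , q<y) = ½ ℚ.* ε , half-pos ε 0<ε , eventually₂
  (λ k x< q< → <-by (ℚ.+-mono-< (<⇒0< x<) (<⇒0< q<))
    (solve 4 (λ e x q y → y := (x :+ con ½ :* e) :+ ((q :+ con ½ :* e :- x) :+ (y :- (q :+ e))))
      refl ε (seq x k) q (seq y k)))
  (≤⇒eventually {x} {fromℚ q} x≤q (½ ℚ.* ε) (half-pos ε 0<ε)) q<y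

<-respʳ-≃ : ∀ {x y z} → x < y → y ≃ z → x < z
<-respʳ-≃ {x} {y} {z} (ε , 0<ε , x<y) y≃z = ½ ℚ.* ε , half-pos ε 0<ε , eventually₂
  (λ k x< y≈z → <-by (ℚ.+-mono-< (<⇒0< x<) (<⇒0< (∣-∣<⇒< (seq y k) (seq z k) y≈z)))
    (solve 4 (λ e x y z → z := (x :+ con ½ :* e) :+ ((y :- (x :+ e)) :+ (z :+ con ½ :* e :- y)))
      refl ε (seq x k) (seq y k) (seq z k)))
  x<y (y≃z (½ ℚ.* ε) (half-pos ε 0<ε))

<-respˡ-≃ : ∀ {x y z} → y < x → y ≃ z → z < x
<-respˡ-≃ {x} {y} {z} (ε , 0<ε , y<x) y≃z = ½ ℚ.* ε , half-pos ε 0<ε , eventually₂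
  (λ k y< y≈z → <-by (ℚ.+-mono-< (<⇒0< y<) (<⇒0< (∣-∣<⇒> (seq y k) (seq z k) y≈z)))
    (solve 4 (λ e x y z → x := (z :+ con ½ :* e) :+ ((x :- (y :+ e)) :+ (y :+ con ½ :* e :- z)))
      refl ε (seq x k) (seq y k) (seq z k)))
  y<x (y≃z (½ ℚ.* ε) (half-pos ε 0<ε))

-- Rational lower bounds for square roots.

square-< : ∀ {p q} → ℚ.- q ℚ.< p → q ℚ.* q ℚ.< p ℚ.* p → q ℚ.< p
square-< {p} {q} -q<p q²<p² = ℚ.≰⇒> λ p≤q →
  ℚ.<-irrefl refl (ℚ.<-≤-trans q²<p² (≤-by (0≤* (≤⇒0≤ p≤q) (ℚ.<⇒≤ (<⇒0< -q<p)))
    (solve 2 (λ p q → q :* q := p :* p :+ (q :- p) :* (p :- (:- q))) refl p q)))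
  where open +-*-Solver using (:-_)

-- The single equation for `η` yields both `η² ≤ ε` and `2 η B ≤ ε`. The first gives `η² < q²` and
-- so `η < q`; the second gives `(q - η)² ≥ q² - 2 η B ≥ a`, as `q < B`.
root-step : ∀ {a ε B q η} → 0ℚ ℚ.≤ a → 0ℚ ℚ.< ε → 0ℚ ℚ.< B → 0ℚ ℚ.< η →
  η ℚ.* (1ℚ ℚ.+ ε ℚ.+ (B ℚ.+ B)) ≡ ε → ℚ.- η ℚ.< q → q ℚ.< B → a ℚ.+ ε ℚ.< q ℚ.* q →
  η ℚ.< q × a ℚ.≤ (q ℚ.- η) ℚ.* (q ℚ.- η)
root-step {a} {ε} {B} {q} {η} 0≤a 0<ε 0<B 0<η ηD≡ε -η<q q<B a+ε<q² = η<q , a≤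
  where
  0≤η = ℚ.<⇒≤ 0<η
  0≤ε = ℚ.<⇒≤ 0<ε
  0≤2B = 0≤+ (ℚ.<⇒≤ 0<B) (ℚ.<⇒≤ 0<B)
  η≤ε : η ℚ.≤ ε
  η≤ε = subst (η ℚ.≤_) ηD≡ε (≤-by (0≤* 0≤η (0≤+ 0≤ε 0≤2B))
    (solve 3 (λ h e B → h :* (con 1ℚ :+ e :+ (B :+ B)) := h :+ h :* (e :+ (B :+ B))) refl η ε B))
  η²≤ε : η ℚ.* η ℚ.≤ ε
  η²≤ε = subst (η ℚ.* η ℚ.≤_) ηD≡ε (≤-by (0≤* 0≤η (0≤+ (0≤+ 0≤1 (≤⇒0≤ η≤ε)) 0≤2B))
    (solve 3 (λ h e B → h :* (con 1ℚ :+ e :+ (B :+ B)) :=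
      h :* h :+ h :* ((con 1ℚ :+ (e :- h)) :+ (B :+ B))) refl η ε B))
  η<q : η ℚ.< q
  η<q = square-< -η<q (ℚ.≤-<-trans (≤-by (0≤+ 0≤a (≤⇒0≤ η²≤ε))
    (solve 3 (λ a e t → a :+ e := t :+ (a :+ (e :- t))) refl a ε (η ℚ.* η))) a+ε<q²)
  2ηB≤ε : η ℚ.* (B ℚ.+ B) ℚ.≤ ε
  2ηB≤ε = subst (η ℚ.* (B ℚ.+ B) ℚ.≤_) ηD≡ε (≤-by (0≤* 0≤η (0≤+ 0≤1 0≤ε))
    (solve 3 (λ h e B → h :* (con 1ℚ :+ e :+ (B :+ B)) := h :* (B :+ B) :+ h :* (con 1ℚ :+ e)) refl η ε B))
  a≤ : a ℚ.≤ (q ℚ.- η) ℚ.* (q ℚ.- η)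
  a≤ = ≤-by
    (0≤+ (0≤+ (0≤+ (ℚ.<⇒≤ (<⇒0< a+ε<q²)) (≤⇒0≤ 2ηB≤ε))
              (0≤* (0≤+ 0≤η 0≤η) (ℚ.<⇒≤ (<⇒0< q<B)))) (0≤² η))
    (solve 5 (λ q h a e B → (q :- h) :* (q :- h) :=
      a :+ ((((q :* q :- (a :+ e)) :+ (e :- h :* (B :+ B))) :+ (h :+ h) :* (B :- q)) :+ h :* h))
      refl q η a ε B)

-- The strict inequality leaves room for a rational, found a little below a late term of `x`.
-- Applied to the inner and to the outer root, this avoids constructing any square root.
rational-root-below : ∀ {a x} → 0ℚ ℚ.≤ a → 0ℝ ≤ x → fromℚ a < x * x →
  ∃[ t ] 0ℚ ℚ.≤ t × a ℚ.≤ t ℚ.* t × fromℚ t < x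
rational-root-below {a} {x} 0≤a 0≤x (ε , 0<ε , N₄ , a<x²) =
  let B , 0<B , N₁ , x<B = bounded (seq x) (cauchy x)
      η , 0<η , ηD≡ε = quotient (0<D 0<B) 0<ε
      N₂ , x-cauchy = cauchy x (½ ℚ.* η) (half-pos η 0<η)
      N₃ , x>-η = ≤⇒eventually {0ℝ} {x} 0≤x η 0<η
      K = (N₁ ⊔ N₂) ⊔ (N₃ ⊔ N₄)
      N₁₂≤K = ℕ.m≤m⊔n (N₁ ⊔ N₂) (N₃ ⊔ N₄)
      N₃₄≤K = ℕ.m≤n⊔m (N₁ ⊔ N₂) (N₃ ⊔ N₄)
      N₂≤K = ℕ.≤-trans (ℕ.m≤n⊔m N₁ N₂) N₁₂≤K
      q = seq x K
      η<q , a≤ = root-step {a} {ε} {B} {q} {η} 0≤a 0<ε 0<B 0<η ηD≡ε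
        (above-neg q η (x>-η K (ℕ.≤-trans (ℕ.m≤m⊔n N₃ N₄) N₃₄≤K)))
        (ℚ.≤-<-trans (p≤∣p∣ q) (x<B K (ℕ.≤-trans (ℕ.m≤m⊔n N₁ N₂) N₁₂≤K)))
        (a<x² K (ℕ.≤-trans (ℕ.m≤n⊔m N₃ N₄) N₃₄≤K))
  -- The tail of `x` stays within `½ * η` of `q`, so `q - η` lies below it with a gap of `½ * η`.
  in q ℚ.- η , ℚ.<⇒≤ (<⇒0< η<q) , a≤ , ½ ℚ.* η , half-pos η 0<η , K , λ k K≤k →
       near (seq x k) q η (∣-∣<⇒> (seq x k) q (x-cauchy k K (ℕ.≤-trans N₂≤K K≤k) N₂≤K))
  where
  open +-*-Solver using (:-_)
  0<D : ∀ {B} → 0ℚ ℚ.< B → 0ℚ ℚ.< 1ℚ ℚ.+ ε ℚ.+ (B ℚ.+ B)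
  0<D 0<B = 0<+ (ℚ.+-mono-< (ℚ.positive⁻¹ 1ℚ) 0<ε) (0≤+ (ℚ.<⇒≤ 0<B) (ℚ.<⇒≤ 0<B))
  above-neg : ∀ q η → 0ℚ ℚ.< q ℚ.+ η → ℚ.- η ℚ.< q
  above-neg q η 0<q+η = <-by 0<q+η (solve 2 (λ q h → q := (:- h) :+ (q :+ h)) refl q η)
  near : ∀ y q η → q ℚ.< y ℚ.+ ½ ℚ.* η → (q ℚ.- η) ℚ.+ ½ ℚ.* η ℚ.< y
  near y q η h = <-by (<⇒0< h)
    (solve 3 (λ y q h → y := (q :- h :+ con ½ :* h) :+ (y :+ con ½ :* h :- q)) refl y q η)

-- The second eigenvalue

dot : ∀ {n} → (Fin n → ℚ) → (Fin n → ℚ) → ℚ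
dot f g = ∑.sum (λ i → f i ℚ.* g i)

dot-comm : ∀ {n} (f g : Fin n → ℚ) → dot f g ≡ dot g f
dot-comm f g = ∑.sum-cong-≗ λ i → ℚ.*-comm (f i) (g i)

dot-linearʳ : ∀ {n} a b (h f g : Fin n → ℚ) →
  dot h (λ i → a ℚ.* f i ℚ.+ b ℚ.* g i) ≡ a ℚ.* dot h f ℚ.+ b ℚ.* dot h g
dot-linearʳ a b h f g = trans
  (∑.sum-cong-≗ λ i → solve 5 (λ a b h f g → h :* (a :* f :+ b :* g) := a :* (h :* f) :+ b :* (h :* g))
    refl a b (h i) (f i) (g i))
  (trans (∑.∑-distrib-+ (λ i → a ℚ.* (h i ℚ.* f i)) (λ i → b ℚ.* (h i ℚ.* g i)))
    (sym (cong₂ ℚ._+_ (∑.*-distribˡ-sum a (λ i → h i ℚ.* f i)) (∑.*-distribˡ-sum b (λ i → h i ℚ.* g i)))))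

dot-scaleʳ : ∀ {n} a (h f : Fin n → ℚ) → dot h (λ i → a ℚ.* f i) ≡ a ℚ.* dot h f
dot-scaleʳ a h f = trans
  (∑.sum-cong-≗ λ i → solve 3 (λ a h f → h :* (a :* f) := a :* (h :* f)) refl a (h i) (f i))
  (sym (∑.*-distribˡ-sum a (λ i → h i ℚ.* f i)))

dot-self-adjoint : ∀ {n} (M : Fin n → Fin n → ℚ) → (∀ i j → M i j ≡ M j i) → ∀ f g →
  dot (λ i → dot (M i) f) g ≡ dot f (λ i → dot (M i) g)
dot-self-adjoint M M-sym f g = begin
  ∑.sum (λ i → dot (M i) f ℚ.* g i)
    ≡⟨ ∑.sum-cong-≗ (λ i → ∑.*-distribʳ-sum (g i) (λ j → M i j ℚ.* f j)) ⟩
  ∑.sum (λ i → ∑.sum (λ j → M i j ℚ.* f j ℚ.* g i))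
    ≡⟨ ∑.∑-comm (λ i j → M i j ℚ.* f j ℚ.* g i) ⟩
  ∑.sum (λ j → ∑.sum (λ i → M i j ℚ.* f j ℚ.* g i))
    ≡⟨ ∑.sum-cong-≗ (λ j → trans (∑.sum-cong-≗ λ i → trans
         (solve 3 (λ m f g → m :* f :* g := f :* (m :* g)) refl (M i j) (f j) (g i))
         (cong (λ m → f j ℚ.* (m ℚ.* g i)) (M-sym i j)))
         (sym (∑.*-distribˡ-sum (f j) (λ i → M j i ℚ.* g i)))) ⟩
  ∑.sum (λ j → f j ℚ.* dot (M j) g) ∎
  where open ≡-Reasoning

-- Unlike _≃_, which unfolds to a Π-type, a record lets x and y be inferred.
infix 4 _≋_
record _≋_ (x y : ℝ) : Set where
  constructor ⟪_⟫
  field ≋⇒≃ : x ≃ y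
open _≋_

pointwise : ∀ {x y} → (∀ k → seq x k ≡ seq y k) → x ≋ y
pointwise {x} {y} eq = ⟪ ≃-pointwise {x} {y} eq ⟫

≋-refl : ∀ x → x ≋ x
≋-refl x = pointwise {x} {x} λ _ → refl

≋-sym : ∀ x y → x ≋ y → y ≋ x
≋-sym x y ⟪ p ⟫ = ⟪ ≃-sym {x} {y} p ⟫

≋-trans : ∀ x y z → x ≋ y → y ≋ z → x ≋ z
≋-trans x y z ⟪ p ⟫ ⟪ q ⟫ = ⟪ ≃-trans {x} {y} {z} p q ⟫

≋-setoid : Setoid 0ℓ 0ℓ
≋-setoid = record
  { Carrier = ℝ
  ; _≈_ = _≋_
  ; isEquivalence = record
    { refl  = λ {x} → ≋-refl x
    ; sym   = λ {x} {y} → ≋-sym x y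
    ; trans = λ {x} {y} {z} → ≋-trans x y z
    }
  }

+-≋ : ∀ x x′ y y′ → x ≋ x′ → y ≋ y′ → x + y ≋ x′ + y′
+-≋ x x′ y y′ ⟪ p ⟫ ⟪ q ⟫ = ⟪ +-cong {x} {x′} {y} {y′} p q ⟫

+-≋ˡ : ∀ x y y′ → y ≋ y′ → x + y ≋ x + y′
+-≋ˡ x y y′ = +-≋ x x y y′ (≋-refl x)

+-≋ʳ : ∀ x x′ y → x ≋ x′ → x + y ≋ x′ + y
+-≋ʳ x x′ y p = +-≋ x x′ y y p (≋-refl y)

*-≋ˡ : ∀ x y y′ → y ≋ y′ → x * y ≋ x * y′
*-≋ˡ x y y′ ⟪ p ⟫ = ⟪ *-congˡ x {y} {y′} p ⟫

infix 7 _•_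
_•_ : ∀ {n} → Vector ℝ n → Vector ℝ n → ℝ
x • y = sum (λ i → x i * y i)

-- Arithmetic on `ℝ` is termwise, so at a fixed index the linear algebra takes place over `ℚ`, and
-- identities valid at every index transfer back through `pointwise`.
_at_ : ∀ {n} → Vector ℝ n → ℕ → Fin n → ℚ
(x at k) i = seq (x i) k

•-at : ∀ {n} (x y : Vector ℝ n) k → seq (x • y) k ≡ dot (x at k) (y at k)
•-at x y k = seq-sum (λ i → x i * y i) k

·-at : ∀ {n} (A : Matrix n) (x : Vector ℝ n) k i → ((A · x) at k) i ≡ dot (A i at k) (x at k)
·-at A x k i = seq-sum (λ j → A i j * x j) k

•-≋ˡ : ∀ {n} (x y y′ : Vector ℝ n) → (∀ i → y i ≋ y′ i) → x • y ≋ x • y′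
•-≋ˡ x y y′ y≋y′ = ⟪ sum-cong {f = λ i → x i * y i} {λ i → x i * y′ i}
  (λ i → *-congˡ (x i) {y i} {y′ i} (≋⇒≃ (y≋y′ i))) ⟫

•-≋ʳ : ∀ {n} (x x′ y : Vector ℝ n) → (∀ i → x i ≋ x′ i) → x • y ≋ x′ • y
•-≋ʳ x x′ y x≋x′ = ⟪ sum-cong {f = λ i → x i * y i} {λ i → x′ i * y i}
  (λ i → *-congʳ {x i} {x′ i} (y i) (≋⇒≃ (x≋x′ i))) ⟫

•-0⇒0 : ∀ {n} (x : Vector ℝ n) → x • x ≃ 0ℝ → ∀ i → x i ≃ 0ℝ
•-0⇒0 x xx≃0 i ε 0<ε = eventually₁
  {λ k → ℚ.∣ seq (x • x) k ℚ.- 0ℚ ∣ ℚ.< ε ℚ.* ε} {λ k → ℚ.∣ seq (x i) k ℚ.- 0ℚ ∣ ℚ.< ε}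
  (λ k h → let
      xx<ε² = subst (seq (x • x) k ℚ.<_) (ℚ.+-identityˡ (ε ℚ.* ε)) (∣-∣<⇒< (seq (x • x) k) 0ℚ h)
      x²<ε² : seq (x i) k ℚ.* seq (x i) k ℚ.< ε ℚ.* ε
      x²<ε² = ℚ.≤-<-trans (term≤sum (λ j → 0≤² (seq (x j) k)) i)
        (subst (ℚ._< ε ℚ.* ε) (•-at x x k) xx<ε²)
    in small (seq (x i) k) x²<ε²)
  (xx≃0 (ε ℚ.* ε) (0<* 0<ε 0<ε))
  where
  small : ∀ p → p ℚ.* p ℚ.< ε ℚ.* ε → ℚ.∣ p ℚ.- 0ℚ ∣ ℚ.< ε
  small p p²<ε² = <⇒∣-∣< p 0ℚ
    (ℚ.<-≤-trans (square-cancel-< p p²<ε²) (ℚ.≤-reflexive (sym (ℚ.+-identityˡ ε))))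
    (<-by (<⇒0< (square-cancel-< (ℚ.- p) (subst (ℚ._< ε ℚ.* ε)
        (solve 1 (λ p → p :* p := (:- p) :* (:- p)) refl p) p²<ε²)))
      (solve 2 (λ p e → p :+ e := con 0ℚ :+ (e :- (:- p))) refl p ε))
    where
    open +-*-Solver using (:-_)
    square-cancel-< : ∀ p → p ℚ.* p ℚ.< ε ℚ.* ε → p ℚ.< ε
    square-cancel-< p p²<ε² = ℚ.≰⇒> λ ε≤p → ℚ.<-irrefl refl (ℚ.<-≤-trans p²<ε²
      (≤-by (0≤* (≤⇒0≤ ε≤p) (0≤+ (ℚ.≤-trans (ℚ.<⇒≤ 0<ε) ε≤p) (ℚ.<⇒≤ 0<ε)))
        (solve 2 (λ p e → p :* p := e :* e :+ (p :- e) :* (p :+ e)) refl p ε)))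

-1ℝ : ℝ
-1ℝ = fromℚ (ℚ.- 1ℚ)

module Eigenpairs {n} (A : Matrix n) (A-sym : ∀ i j k → seq (A i j) k ≡ seq (A j i) k)
  (μ ν : ℝ) (f h : Vector ℝ n)
  (Af : ∀ i → (A · f) i ≋ μ * f i) (Ah : ∀ i → (A · h) i ≋ ν * h i) where

  gap : ℝ
  gap = μ + -1ℝ * ν

  -- Symmetry of `A` gives `μ ⟨f, h⟩ = ν ⟨f, h⟩`. The factor `gap` is kept: the eigenvalues may
  -- coincide, and then `f` and `h` need not be orthogonal.
  orthogonal : gap * (f • h) ≋ 0ℝ
  orthogonal = begin
    gap * (f • h)
      ≈⟨ pointwise (λ k → solve 3 (λ m n p → (m :+ con (ℚ.- 1ℚ) :* n) :* p := m :* p :+ con (ℚ.- 1ℚ) :* (n :* p))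
           refl (seq μ k) (seq ν k) (seq (f • h) k)) ⟩
    μ * (f • h) + -1ℝ * (ν * (f • h))
      ≈⟨ +-≋ʳ (μ * (f • h)) (ν * (f • h)) (-1ℝ * (ν * (f • h))) eq ⟩
    ν * (f • h) + -1ℝ * (ν * (f • h))
      ≈⟨ pointwise (λ k → solve 1 (λ p → p :+ con (ℚ.- 1ℚ) :* p := con 0ℚ) refl (seq (ν * (f • h)) k)) ⟩
    0ℝ ∎
    where
    open SetoidReasoning ≋-setoid
    eq : μ * (f • h) ≋ ν * (f • h)
    eq = begin
      μ * (f • h)                 ≈⟨ pointwise (λ k → trans (cong (seq μ k ℚ.*_) (trans (•-at f h k) (dot-comm (f at k) (h at k))))
                                       (trans (sym (dot-scaleʳ (seq μ k) (h at k) (f at k)))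
                                         (trans (dot-comm (h at k) (λ i → seq μ k ℚ.* seq (f i) k)) (sym (•-at (λ i → μ * f i) h k))))) ⟩
      (λ i → μ * f i) • h         ≈⟨ •-≋ʳ (λ i → μ * f i) (A · f) h (λ i → ≋-sym ((A · f) i) (μ * f i) (Af i)) ⟩
      (A · f) • h                 ≈⟨ pointwise (λ k → trans (•-at (A · f) h k)
                                       (trans (∑.sum-cong-≗ λ i → cong (ℚ._* seq (h i) k) (·-at A f k i))
                                       (trans (dot-self-adjoint (λ i → A i at k) (λ i j → A-sym i j k) (f at k) (h at k))
                                       (trans (∑.sum-cong-≗ λ i → cong (seq (f i) k ℚ.*_) (sym (·-at A h k i)))
                                         (sym (•-at f (A · h) k)))))) ⟩
      f • (A · h)                 ≈⟨ •-≋ˡ f (A · h) (λ i → ν * h i) Ah ⟩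
      f • (λ i → ν * h i)         ≈⟨ pointwise (λ k → trans (•-at f (λ i → ν * h i) k)
                                       (trans (dot-scaleʳ (seq ν k) (f at k) (h at k))
                                         (cong (seq ν k ℚ.*_) (sym (•-at f h k))))) ⟩
      ν * (f • h) ∎

  -- Since (μ - ν) ⟨f, h⟩ = 0, no cross term survives.
  quadratic-form : ∀ α β (g : Vector ℝ n) → (∀ i → g i ≋ α * f i + β * h i) →
    g • (A · g) ≋ ν * (g • g) + (α * α * (f • f)) * gap
  quadratic-form α β g g≋ = begin
    g • (A · g)
      ≈⟨ •-≋ˡ g (A · g) (λ i → ν * g i + (α * gap) * f i) Ag ⟩
    g • (λ i → ν * g i + (α * gap) * f i)
      ≈⟨ pointwise (λ k → trans (•-at g (λ i → ν * g i + (α * gap) * f i) k)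
           (trans (dot-linearʳ (seq ν k) (seq (α * gap) k) (g at k) (g at k) (f at k))
             (cong₂ (λ p q → seq ν k ℚ.* p ℚ.+ seq (α * gap) k ℚ.* q) (sym (•-at g g k)) (sym (•-at g f k))))) ⟩
    ν * (g • g) + (α * gap) * (g • f)
      ≈⟨ +-≋ˡ (ν * (g • g)) ((α * gap) * (g • f)) ((α * gap) * (α * (f • f) + β * (f • h)))
           (*-≋ˡ (α * gap) (g • f) (α * (f • f) + β * (f • h)) g•f) ⟩
    ν * (g • g) + (α * gap) * (α * (f • f) + β * (f • h))
      ≈⟨ pointwise (λ k → solve 6 (λ s a d p b q → s :+ (a :* d) :* (a :* p :+ b :* q) :=
           (s :+ (a :* a :* p) :* d) :+ (a :* b) :* (d :* q)) refl
           (seq (ν * (g • g)) k) (seq α k) (seq gap k) (seq (f • f) k) (seq β k) (seq (f • h) k)) ⟩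
    (ν * (g • g) + (α * α * (f • f)) * gap) + (α * β) * (gap * (f • h))
      ≈⟨ +-≋ˡ (ν * (g • g) + (α * α * (f • f)) * gap) ((α * β) * (gap * (f • h))) ((α * β) * 0ℝ)
           (*-≋ˡ (α * β) (gap * (f • h)) 0ℝ orthogonal) ⟩
    (ν * (g • g) + (α * α * (f • f)) * gap) + (α * β) * 0ℝ
      ≈⟨ pointwise (λ k → solve 2 (λ p q → p :+ q :* con 0ℚ := p) refl
           (seq (ν * (g • g) + (α * α * (f • f)) * gap) k) (seq (α * β) k)) ⟩
    ν * (g • g) + (α * α * (f • f)) * gap ∎
    where
    open SetoidReasoning ≋-setoid
    g•f : g • f ≋ α * (f • f) + β * (f • h)
    g•f = begin
      g • f                             ≈⟨ •-≋ʳ g (λ i → α * f i + β * h i) f g≋ ⟩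
      (λ i → α * f i + β * h i) • f     ≈⟨ pointwise (λ k → trans (•-at (λ i → α * f i + β * h i) f k)
        (trans (dot-comm ((λ i → α * f i + β * h i) at k) (f at k))
        (trans (dot-linearʳ (seq α k) (seq β k) (f at k) (f at k) (h at k))
          (cong₂ (λ p q → seq α k ℚ.* p ℚ.+ seq β k ℚ.* q) (sym (•-at f f k)) (sym (•-at f h k)))))) ⟩
      α * (f • f) + β * (f • h) ∎
    Ag : ∀ i → (A · g) i ≋ ν * g i + (α * gap) * f i
    Ag i = begin
      (A · g) i                                  ≈⟨ •-≋ˡ (A i) g (λ j → α * f j + β * h j) g≋ ⟩
      (A · (λ j → α * f j + β * h j)) i          ≈⟨ pointwise (λ k → trans (·-at A (λ j → α * f j + β * h j) k i)
        (trans (dot-linearʳ (seq α k) (seq β k) (A i at k) (f at k) (h at k))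
          (cong₂ (λ p q → seq α k ℚ.* p ℚ.+ seq β k ℚ.* q) (sym (·-at A f k i)) (sym (·-at A h k i))))) ⟩
      α * (A · f) i + β * (A · h) i              ≈⟨ +-≋ (α * (A · f) i) (α * (μ * f i)) (β * (A · h) i) (β * (ν * h i))
        (*-≋ˡ α ((A · f) i) (μ * f i) (Af i)) (*-≋ˡ β ((A · h) i) (ν * h i) (Ah i)) ⟩
      α * (μ * f i) + β * (ν * h i)              ≈⟨ pointwise (λ k → solve 6 (λ a m f b n h →
        a :* (m :* f) :+ b :* (n :* h) := n :* (a :* f :+ b :* h) :+ (a :* (m :+ con (ℚ.- 1ℚ) :* n)) :* f)
        refl (seq α k) (seq μ k) (seq (f i) k) (seq β k) (seq ν k) (seq (h i) k)) ⟩
      ν * (α * f i + β * h i) + (α * gap) * f i  ≈⟨ +-≋ʳ (ν * (α * f i + β * h i)) (ν * g i) ((α * gap) * f i)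
        (*-≋ˡ ν (α * f i + β * h i) (g i) (≋-sym (g i) (α * f i + β * h i) (g≋ i))) ⟩
      ν * g i + (α * gap) * f i ∎

  module _ (ℓ : ℚ) (ℓ<ν : fromℚ ℓ < ν) (ν≤μ : ν ≤ μ) where

    -- The form of `g` is at most `ℓ (g • g)` by the hypothesis and at least `ν (g • g)` by
    -- `quadratic-form`, as `c` and `gap` are non-negative; since `ℓ < ν`, `g • g` is 0. Giving `g`
    -- only up to `≋` allows its terms to be chosen exactly 0 at a vertex.
    vanishing : ∀ α β (g : Vector ℝ n) → (∀ i → g i ≋ α * f i + β * h i) →
      (∀ k → dot (g at k) (λ i → dot (A i at k) (g at k)) ℚ.≤ ℓ ℚ.* dot (g at k) (g at k)) →
      ∀ i → g i ≃ 0ℝ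
    vanishing α β g g≋ bound = •-0⇒0 g g•g≃0
      where
      c : ℝ
      c = α * α * (f • f)
      0≤c : ∀ k → 0ℚ ℚ.≤ seq c k
      0≤c k = 0≤* (0≤² (seq α k)) (subst (0ℚ ℚ.≤_) (sym (•-at f f k)) (0≤sum λ i → 0≤² (seq (f i) k)))
      0≤g•g : ∀ k → 0ℚ ℚ.≤ seq (g • g) k
      0≤g•g k = subst (0ℚ ℚ.≤_) (sym (•-at g g k)) (0≤sum λ i → 0≤² (seq (g i) k))
      form≤ : ∀ k → seq (g • (A · g)) k ℚ.≤ ℓ ℚ.* seq (g • g) k
      form≤ k = subst₂ ℚ._≤_
        (sym (trans (•-at g (A · g) k) (∑.sum-cong-≗ λ i → cong (seq (g i) k ℚ.*_) (·-at A g k i))))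
        (cong (ℓ ℚ.*_) (sym (•-at g g k))) (bound k)

      g•g≃0 : g • g ≃ 0ℝ
      g•g≃0 ε 0<ε =
        let η , 0<η , ℓ+η<ν = ℓ<ν
            B , 0<B , c<B = bounded (seq c) (cauchy c)
            -- Since `ν - ℓ` exceeds `η`, a total error of `η ε` suffices. One half absorbs the
            -- error in `quadratic-form`; the other is `δ B`, because `c * gap` is eventually at
            -- least `- δ B`.
            θ = ½ ℚ.* (η ℚ.* ε)
            0<θ = half-pos (η ℚ.* ε) (0<* 0<η 0<ε)
            δ , 0<δ , δB≡θ = quotient 0<B 0<θ
        in eventually₂ (λ k p q → final k η ε B δ θ 0<η 0<δ refl δB≡θ (proj₁ p) (proj₂ p) (proj₁ q) (proj₂ q))
             (eventually₂ (λ _ → _,_) ℓ+η<ν c<B)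
             (eventually₂ (λ _ → _,_) (≤⇒eventually {ν} {μ} ν≤μ δ 0<δ)
               (≋⇒≃ (quadratic-form α β g g≋) θ 0<θ))
        where
        final : ∀ k η ε B δ θ → 0ℚ ℚ.< η → 0ℚ ℚ.< δ → θ ≡ ½ ℚ.* (η ℚ.* ε) → δ ℚ.* B ≡ θ →
          ℓ ℚ.+ η ℚ.< seq ν k → ℚ.∣ seq c k ∣ ℚ.< B → seq ν k ℚ.< seq μ k ℚ.+ δ →
          ℚ.∣ seq (g • (A · g)) k ℚ.- (seq ν k ℚ.* seq (g • g) k ℚ.+ seq c k ℚ.* seq gap k) ∣ ℚ.< θ →
          ℚ.∣ seq (g • g) k ℚ.- 0ℚ ∣ ℚ.< ε
        final k η ε B δ θ 0<η 0<δ θ≡ δB≡θ ℓ+η<ν c<B ν<μ+δ near = subst (ℚ._< ε)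
          (sym (trans (cong ℚ.∣_∣ (ℚ.+-identityʳ S)) (ℚ.0≤p⇒∣p∣≡p (0≤g•g k))))
          (ℚ.*-cancelˡ-<-nonNeg η {{ℚ.nonNegative (ℚ.<⇒≤ 0<η)}} (begin-strict
            η ℚ.* S
              ≤⟨ ≤-by (0≤* (0≤g•g k) (ℚ.<⇒≤ (<⇒0< ℓ+η<ν)))
                   (solve 4 (λ h S n l → (n :- l) :* S := h :* S :+ S :* (n :- (l :+ h))) refl η S N ℓ) ⟩
            (N ℚ.- ℓ) ℚ.* S
              <⟨ <-by (<⇒0< (ℚ.<-≤-trans (∣-∣<⇒> Q (N ℚ.* S ℚ.+ D) near) (ℚ.+-monoˡ-≤ θ (form≤ k))))
                   (solve 5 (λ n l S D t → t :- D :=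
                      (n :- l) :* S :+ (l :* S :+ t :- (n :* S :+ D))) refl N ℓ S D θ) ⟩
            θ ℚ.- D
              ≤⟨ ≤-by (0≤* (0≤c k) (ℚ.<⇒≤ (<⇒0< ν<μ+δ)))
                   (solve 5 (λ t C m n d → t :+ C :* d :=
                      (t :- C :* (m :+ con (ℚ.- 1ℚ) :* n)) :+ C :* (m :+ d :- n)) refl θ C (seq μ k) N δ) ⟩
            θ ℚ.+ C ℚ.* δ
              ≤⟨ ℚ.+-monoʳ-≤ θ (ℚ.*-monoʳ-≤-nonNeg δ {{ℚ.nonNegative (ℚ.<⇒≤ 0<δ)}} (ℚ.<⇒≤ C<B)) ⟩
            θ ℚ.+ B ℚ.* δ
              ≡⟨ cong₂ ℚ._+_ θ≡ (trans (ℚ.*-comm B δ) (trans δB≡θ θ≡)) ⟩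
            ½ ℚ.* (η ℚ.* ε) ℚ.+ ½ ℚ.* (η ℚ.* ε)
              ≡⟨ halves (η ℚ.* ε) ⟩
            η ℚ.* ε ∎))
          where
          open ℚ.≤-Reasoning
          C = seq c k
          S = seq (g • g) k
          N = seq ν k
          D = C ℚ.* seq gap k
          Q = seq (g • (A · g)) k
          C<B : C ℚ.< B
          C<B = subst (ℚ._< B) (ℚ.0≤p⇒∣p∣≡p (0≤c k)) c<B

-- The quadratic form of a tree.

adjacency-at : ∀ {n} (G : Graph n) i j k →
  seq (adjacencyMatrix G i j) k ≡ (if adj G i j then 1ℚ else 0ℚ)
adjacency-at G i j k with adj G i j
... | true  = refl
... | false = refl

adjacency-sym : ∀ {n} (G : Graph n) i j k →
  seq (adjacencyMatrix G i j) k ≡ seq (adjacencyMatrix G j i) k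
adjacency-sym G i j k = trans (adjacency-at G i j k)
  (trans (cong (if_then 1ℚ else 0ℚ) (symmetric G i j)) (sym (adjacency-at G j i k)))

module _ {n} (G : Graph n) (G-tree : IsTree G) (r b : Fin n) where
  open TreeRooting G (proj₁ G-tree) (proj₂ G-tree) r
  open Ancestors tree
  open Certificate tree b

  -- By `adjacency-split` each edge occurs once from either end, and exchanging the summations
  -- identifies the two halves.
  adjacency-form : ∀ x k →
    dot x (λ i → dot (adjacencyMatrix G i at k) x) ≡
    ∑.sum (λ c → ∑.sum (λ u → child c u ℚ.* (x c ℚ.* x u))) ℚ.+
    ∑.sum (λ c → ∑.sum (λ u → child c u ℚ.* (x c ℚ.* x u)))
  adjacency-form x k = begin
    ∑.sum (λ u → x u ℚ.* dot (adjacencyMatrix G u at k) x)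
      ≡⟨ ∑.sum-cong-≗ (λ u → trans (∑.*-distribˡ-sum (x u) (λ w → seq (adjacencyMatrix G u w) k ℚ.* x w))
           (trans (∑.sum-cong-≗ (split u)) (∑.∑-distrib-+ (down u) (λ w → down w u)))) ⟩
    ∑.sum (λ u → ∑.sum (down u) ℚ.+ ∑.sum (λ w → down w u))
      ≡⟨ ∑.∑-distrib-+ (λ u → ∑.sum (down u)) (λ u → ∑.sum (λ w → down w u)) ⟩
    ∑.sum (λ u → ∑.sum (down u)) ℚ.+ ∑.sum (λ u → ∑.sum (λ w → down w u))
      ≡⟨ cong (λ t → ∑.sum (λ u → ∑.sum (down u)) ℚ.+ t) (∑.∑-comm (λ u w → down w u)) ⟩
    ∑.sum (λ u → ∑.sum (down u)) ℚ.+ ∑.sum (λ u → ∑.sum (down u)) ∎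
    where
    open ≡-Reasoning
    down : Fin n → Fin n → ℚ
    down c u = child c u ℚ.* (x c ℚ.* x u)
    split : ∀ u w → x u ℚ.* (seq (adjacencyMatrix G u w) k ℚ.* x w) ≡ down u w ℚ.+ down w u
    split u w = trans
      (cong (λ a → x u ℚ.* (a ℚ.* x w)) (trans (adjacency-at G u w k) (adjacency-split u w)))
      (solve 4 (λ p q y z → y :* ((p :+ q) :* z) := p :* (y :* z) :+ q :* (z :* y)) refl
        (child u w) (child w u) (x u) (x w))

  half-value : half ≡ ½ ℚ.* (ι n ℚ.- ι (suc (δ b)))
  half-value = cong (½ ℚ.*_) (sum-non-ancestors tree b)

  Admissible : ℚ → Set
  Admissible ℓ = 0ℚ ℚ.< ℓ × 2ℚ ℚ.≤ ℓ ℚ.* ℓ × half ℚ.* half ℚ.+ 4ℚ ℚ.≤ (ℓ ℚ.* ℓ ℚ.- 2ℚ) ℚ.* (ℓ ℚ.* ℓ ℚ.- 2ℚ)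

  cut-vertex : ∃[ v ] ∀ ℓ → Admissible ℓ → ∀ k x → x v ≡ 0ℚ →
    dot x (λ i → dot (adjacencyMatrix G i at k) x) ℚ.≤ ℓ ℚ.* dot x x
  cut-vertex =
    let v , heavy , deepest = deepest-heavy in
    v , λ ℓ (0<ℓ , 2≤ℓ² , bound) k x xv≡0 → subst (ℚ._≤ ℓ ℚ.* dot x x) (sym (adjacency-form x k))
      (Cut.Weights.Bound.form-bound tree b v heavy deepest ℓ 0<ℓ 2≤ℓ² bound x xv≡0)

-- The second eigenvalue and the form on a coordinate hyperplane.

module _ {n} (A : Matrix n) (A-sym : ∀ i j k → seq (A i j) k ≡ seq (A j i) k)
  (μ ν : ℝ) (f h : Vector ℝ n)
  (Af : ∀ i → (A · f) i ≋ μ * f i) (Ah : ∀ i → (A · h) i ≋ ν * h i)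
  (independent : ∀ α β → (∀ i → α * f i + β * h i ≋ 0ℝ) → α ≋ 0ℝ × β ≋ 0ℝ)
  (ℓ : ℚ) (v : Fin n)
  (bound : ∀ k x → x v ≡ 0ℚ → dot x (λ i → dot (A i at k) x) ℚ.≤ ℓ ℚ.* dot x x) where

  -- ⟨g, A g⟩ > ℓ ⟨g, g⟩ for every g ≠ 0 in the span of f and h, and some such
  -- g vanishes at v.
  smaller-eigenvalue≤ : ν ≤ μ → ν ≤ fromℚ ℓ
  smaller-eigenvalue≤ ν≤μ ℓ<ν = contradiction (_≋_.≋⇒≃ 1≋0 1ℚ (ℚ.positive⁻¹ 1ℚ))
    λ (N , p) → ℚ.<-irrefl refl (p N ℕ.≤-refl)
    where
    both-zero : ∀ α β g → (∀ i → g i ≋ α * f i + β * h i) → (∀ k → seq (g v) k ≡ 0ℚ) →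
      α ≋ 0ℝ × β ≋ 0ℝ
    both-zero α β g g≋ gv≡0 = independent α β λ i →
      ≋-trans (α * f i + β * h i) (g i) 0ℝ (≋-sym (g i) (α * f i + β * h i) (g≋ i))
        ⟪ Eigenpairs.vanishing A A-sym μ ν f h Af Ah ℓ ℓ<ν ν≤μ α β g g≋
            (λ k → bound k (g at k) (gv≡0 k)) i ⟫

    -- The combination `h v * f - f v * h` vanishes at `v` at every index, so both its coefficients
    -- are 0, in particular `f v`.
    fv≋0 : f v ≋ 0ℝ
    fv≋0 = ≋-trans (f v) (-1ℝ * (-1ℝ * f v)) 0ℝ
      (pointwise λ k → solve 1 (λ p → p := con (ℚ.- 1ℚ) :* (con (ℚ.- 1ℚ) :* p)) refl (seq (f v) k))
      (≋-trans (-1ℝ * (-1ℝ * f v)) (-1ℝ * 0ℝ) 0ℝ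
        (*-≋ˡ -1ℝ (-1ℝ * f v) 0ℝ (proj₂ (both-zero (h v) (-1ℝ * f v)
          (λ i → h v * f i + (-1ℝ * f v) * h i)
          (λ i → ≋-refl (h v * f i + (-1ℝ * f v) * h i))
          λ k → solve 2 (λ p q → q :* p :+ (con (ℚ.- 1ℚ) :* p) :* q := con 0ℚ) refl
            (seq (f v) k) (seq (h v) k))))
        (pointwise λ _ → refl))

    -- `f v ≋ 0ℝ` does not make the terms of `f v` zero, which `both-zero` demands. Overwriting that
    -- entry does, and the result is still `1 f + 0 h` up to `≋`, so independence gives the absurd
    -- `1ℝ ≋ 0ℝ`.
    masked : Vector ℝ n
    masked i = if does (i ≟ v) then 0ℝ else f i

    masked-v : ∀ k → seq (masked v) k ≡ 0ℚ
    masked-v k = cong (λ b → seq (if b then 0ℝ else f v) k) (dec-true (v ≟ v) refl)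

    masked≋ : ∀ i → masked i ≋ 1ℝ * f i + 0ℝ * h i
    masked≋ i = ≋-trans (masked i) (f i) (1ℝ * f i + 0ℝ * h i) ≋f
      (pointwise λ k → solve 2 (λ p q → p := con 1ℚ :* p :+ con 0ℚ :* q) refl (seq (f i) k) (seq (h i) k))
      where
      ≋f : masked i ≋ f i
      ≋f with i ≟ v
      ... | yes refl = ≋-sym (f v) 0ℝ fv≋0
      ... | no _     = ≋-refl (f i)

    1≋0 : 1ℝ ≋ 0ℝ
    1≋0 = proj₁ (both-zero 1ℝ 0ℝ masked masked≋ masked-v)

coefficients : ∀ {m} → ℝ → ℝ → Vector ℝ (suc (suc m))
coefficients α β zero          = α
coefficients α β (suc zero)    = β
coefficients α β (suc (suc _)) = 0ℝ

dot-two : ∀ {m} (c y : Fin (suc (suc m)) → ℚ) → (∀ j → c (suc (suc j)) ≡ 0ℚ) →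
  dot c y ≡ c zero ℚ.* y zero ℚ.+ c (suc zero) ℚ.* y (suc zero)
dot-two {m} c y c≡0 = cong (c zero ℚ.* y zero ℚ.+_) (trans
  (cong (c (suc zero) ℚ.* y (suc zero) ℚ.+_)
    (sum-0 {m} {λ j → c (suc (suc j)) ℚ.* y (suc (suc j))} λ j →
      trans (cong (ℚ._* y (suc (suc j))) (c≡0 j)) (ℚ.*-zeroˡ (y (suc (suc j))))))
  (ℚ.+-identityʳ (c (suc zero) ℚ.* y (suc zero))))

combination : ∀ {m n} α β (x : Fin (suc (suc m)) → Vector ℝ n) i →
  sum (λ k → coefficients α β k * x k i) ≋ α * x zero i + β * x (suc zero) i
combination α β x i = pointwise λ k → trans (seq-sum (λ j → coefficients α β j * x j i) k)
  (dot-two (λ j → seq (coefficients α β j) k) (λ j → seq (x j i) k) λ _ → refl)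

independent-pair : ∀ {m n} (x : Fin (suc (suc m)) → Vector ℝ n) → LinearlyIndependent x →
  ∀ α β → (∀ i → α * x zero i + β * x (suc zero) i ≋ 0ℝ) → α ≋ 0ℝ × β ≋ 0ℝ
independent-pair x independent α β eq = ⟪ zeros zero ⟫ , ⟪ zeros (suc zero) ⟫
  where
  zeros : ∀ k → coefficients α β k ≃ 0ℝ
  zeros = independent (coefficients α β) λ i → _≋_.≋⇒≃
    (≋-trans (sum (λ k → coefficients α β k * x k i)) (α * x zero i + β * x (suc zero) i) 0ℝ
      (combination α β x i) (eq i))

second-eigenvalue≤ : ∀ {n} (A : Matrix n) → (∀ i j k → seq (A i j) k ≡ seq (A j i) k) →
  ∀ ℓ v → (∀ k x → x v ≡ 0ℚ → dot x (λ i → dot (A i at k) x) ℚ.≤ ℓ ℚ.* dot x x) →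
  ∀ μ → IsSecondLargestEigenvalue A μ → μ ≤ fromℚ ℓ
second-eigenvalue≤ {suc zero}    A A-sym ℓ v bound μ (_ , _ , zero , () , _)
second-eigenvalue≤ {suc (suc m)} A A-sym ℓ v bound μ (_ , _ , zero , () , _)
second-eigenvalue≤ {suc (suc m)} A A-sym ℓ v bound μ (_ , _ , suc (suc _) , () , _)
-- The conclusion is a negation, so `ℓ<μ` arrives as a further argument; it is carried over to the
-- eigenvalue at position 1 and refuted there.
second-eigenvalue≤ {suc (suc m)} A A-sym ℓ v bound μ (eig , spectrum , suc zero , _ , μ≃) ℓ<μ =
  smaller-eigenvalue≤ A A-sym (eig zero) (eig (suc zero)) (vec zero) (vec (suc zero))
    (λ i → ⟪ eigen zero i ⟫) (λ i → ⟪ eigen (suc zero) i ⟫) (independent-pair vec independent) ℓ v bound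
    (decreasing zero (suc zero) z≤n)
    (<-respʳ-≃ {fromℚ ℓ} {μ} {eig (suc zero)} ℓ<μ μ≃)
  where open IsSpectrum spectrum

-- Choice of the rational bound and conclusion.

open import Data.Integer using (+_)
open import Data.Rational using (_/_)

corollary1p1 : (n d : ℕ) → 4 ℕ.≤ n → 3 ℕ.≤ d → d ℕ.≤ n ∸ 2 →
    (λ₂* : ℝ) → IsMaxλ₂ n d λ₂* →
    (r s : ℝ) →
    r IsSqrtOf (fromℚ ((+ n ℤ.- + d) / 2) * fromℚ ((+ n ℤ.- + d) / 2) + fromℚ (+ 4 / 1)) →
    s IsSqrtOf (fromℚ (+ 2 / 1) + r) →
    λ₂* < s
corollary1p1 n d _ _ _ λ₂*
  ((μ , (G , (G-tree , (b , root , diametral) , _) , isλ₂) , λ₂*≃μ) , _) r s (0≤r , r²≃) (0≤s , s²≃) =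
  <-respˡ-≃ {s} {μ} {λ₂*}
    (≤-<-transℚ {μ} {ℓ} {s}
      (second-eigenvalue≤ (adjacencyMatrix G) (adjacency-sym G) ℓ v (v-bound ℓ admissible) μ isλ₂) ℓ<s)
    (≃-sym {λ₂*} {μ} λ₂*≃μ)
  where
  module T = TreeRooting G (proj₁ G-tree) (proj₂ G-tree) root
  p half : ℚ
  p    = (+ n ℤ.- + d) / 2
  half = Certificate.half T.tree b

  v = proj₁ (cut-vertex G G-tree root b)
  v-bound = proj₂ (cut-vertex G G-tree root b)

  -- The path has `d + 1` vertices, so `half` is `(n - d - 1) / 2`; the missing `½` is the slack
  -- used next.
  p≡half+½ : p ≡ half ℚ.+ ½
  p≡half+½ = begin
    p                                           ≡⟨ half-difference n d ⟩
    ½ ℚ.* (ι n ℚ.- ι d)                         ≡⟨ solve 2 (λ a b → con ½ :* (a :- b) :=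
                                                     con ½ :* (a :- (con 1ℚ :+ b)) :+ con ½) refl (ι n) (ι d) ⟩
    ½ ℚ.* (ι n ℚ.- (1ℚ ℚ.+ ι d)) ℚ.+ ½          ≡⟨ cong (λ t → ½ ℚ.* (ι n ℚ.- t) ℚ.+ ½) (sym (ι-suc d)) ⟩
    ½ ℚ.* (ι n ℚ.- ι (suc d)) ℚ.+ ½             ≡⟨ cong (λ k → ½ ℚ.* (ι n ℚ.- ι (suc k)) ℚ.+ ½) (sym (T.distance-unique diametral)) ⟩
    ½ ℚ.* (ι n ℚ.- ι (suc (T.δ b))) ℚ.+ ½       ≡⟨ cong (ℚ._+ ½) (sym (half-value G G-tree root b)) ⟩
    half ℚ.+ ½                                  ∎
    where open ≡-Reasoning

  0≤half : 0ℚ ℚ.≤ half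
  0≤half = Certificate.0≤half T.tree b

  half²+4<r² : fromℚ (half ℚ.* half ℚ.+ 4ℚ) < r * r
  half²+4<r² = <-respʳ-≃ {fromℚ (half ℚ.* half ℚ.+ 4ℚ)} {fromℚ p * fromℚ p + fromℚ (+ 4 / 1)} {r * r}
    -- `(half + ½)²` exceeds `half²` by `half + ¼`. One `⅛` is the uniform gap demanded by `_<_`,
    -- the other keeps the inequality strict.
    (⅛ , ℚ.positive⁻¹ ⅛ , always λ _ → <-by (0<+ (ℚ.positive⁻¹ ⅛) 0≤half)
      (trans (cong (λ t → t ℚ.* t ℚ.+ 4ℚ) p≡half+½)
        (solve 1 (λ h → (h :+ con ½) :* (h :+ con ½) :+ con 4ℚ :=
          (h :* h :+ con 4ℚ) :+ con ⅛ :+ (con ⅛ :+ h)) refl half)))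
    (≃-sym {r * r} {fromℚ p * fromℚ p + fromℚ (+ 4 / 1)} r²≃)
    where
    ⅛ : ℚ
    ⅛ = ½ ℚ.* (½ ℚ.* ½)

  -- A rational `ρ < r` with `half² + 4 ≤ ρ²`, and then a rational `ℓ < s` with `2 + ρ ≤ ℓ²`, stand
  -- in for the nested roots. `ℓ² - 2 ≥ ρ ≥ 0` makes `ℓ` admissible.
  ρ-root = rational-root-below {half ℚ.* half ℚ.+ 4ℚ} {r}
    (0≤+ (0≤² half) (ℚ.nonNegative⁻¹ 4ℚ)) 0≤r half²+4<r²
  ρ = proj₁ ρ-root
  0≤ρ = proj₁ (proj₂ ρ-root)
  half²+4≤ρ² = proj₁ (proj₂ (proj₂ ρ-root))
  ρ<r = proj₂ (proj₂ (proj₂ ρ-root))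

  2+ρ<s² : fromℚ (2ℚ ℚ.+ ρ) < s * s
  2+ρ<s² = <-respʳ-≃ {fromℚ (2ℚ ℚ.+ ρ)} {fromℚ (+ 2 / 1) + r} {s * s}
    (let ε , 0<ε , ρ+ε<r = ρ<r in
     ε , 0<ε , eventually₁ (λ k h → subst (ℚ._< (+ 2 / 1) ℚ.+ seq r k) (sym (ℚ.+-assoc 2ℚ ρ ε))
       (ℚ.+-monoʳ-< 2ℚ h)) ρ+ε<r)
    (≃-sym {s * s} {fromℚ (+ 2 / 1) + r} s²≃)

  ℓ-root = rational-root-below {2ℚ ℚ.+ ρ} {s} (0≤+ (ℚ.nonNegative⁻¹ 2ℚ) 0≤ρ) 0≤s 2+ρ<s²
  ℓ = proj₁ ℓ-root
  0≤ℓ = proj₁ (proj₂ ℓ-root)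
  2+ρ≤ℓ² = proj₁ (proj₂ (proj₂ ℓ-root))
  ℓ<s = proj₂ (proj₂ (proj₂ ℓ-root))

  2≤ℓ² : 2ℚ ℚ.≤ ℓ ℚ.* ℓ
  2≤ℓ² = ℚ.≤-trans (≤-by 0≤ρ refl) 2+ρ≤ℓ²

  admissible : Admissible G G-tree root b ℓ
  admissible = 0<ℓ , 2≤ℓ² , ℚ.≤-trans half²+4≤ρ² ρ²≤
    where
    0<ℓ : 0ℚ ℚ.< ℓ
    0<ℓ = ℚ.≰⇒> λ ℓ≤0 → ℚ.<-irrefl refl (ℚ.<-≤-trans (ℚ.positive⁻¹ 2ℚ)
      (subst (λ t → 2ℚ ℚ.≤ t ℚ.* t) (ℚ.≤-antisym ℓ≤0 0≤ℓ) 2≤ℓ²))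
    ρ²≤ : ρ ℚ.* ρ ℚ.≤ (ℓ ℚ.* ℓ ℚ.- 2ℚ) ℚ.* (ℓ ℚ.* ℓ ℚ.- 2ℚ)
    ρ²≤ = ≤-by (0≤* (≤⇒0≤ 2+ρ≤ℓ²) (0≤+ (≤⇒0≤ 2≤ℓ²) 0≤ρ))
      (solve 2 (λ L ρ → (L :- con 2ℚ) :* (L :- con 2ℚ) :=
        ρ :* ρ :+ (L :- (con 2ℚ :+ ρ)) :* ((L :- con 2ℚ) :+ ρ)) refl (ℓ ℚ.* ℓ) ρ)
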